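{- Let $\mathscr D=\{d_1,\ldots,d_n\}$ be a set of positive integers with $d_1>d_2>\cdots>d_n$ such that $d_n$ divides $d$ for every $d\in\mathscr D$. Let $\mathbf s=d_1,\ldots,d_n$, let \[ c=\max_{1\le k\le n-1}\left\lceil \frac{ -\Delta_{\mathbf s}(k)}{\min\{k,d_n\}}\right\rceil, \] and let \[ C^{\star}=\begin{cases} c & \text{if } d_n \text{ and } \sigma(\mathscr D) \text{ are even};\\ c & \text{if } d_n \text{ is odd and } \sigma(\mathscr D)+cd_n \text{ is even};\\ c+1 & \text{if } d_n \text{ and } \sigma(\mathscr D)+cd_n \text{ are odd}.\end{cases} \] Then \[ \ell_q(\mathscr D)=\tfrac12\big(\sigma(\mathscr D)+C^{\star}\min\mathscr D\big). \]
   Context: All graphs are finite and simple. The degree set of a graph $G$ is the set of distinct degrees of its vertices. For a finite nonempty set $\mathscr D$ of positive integers, $\ell_q(\mathscr D)$ denotes the least number of edges of a simple graph whose degree set is exactly $\mathscr D$. $\sigma(\mathscr D)$ is the sum of the elements of $\mathscr D$. For a sequence $\mathbf s=a_1,\ldots,a_p$ and $1\le k\le p$, define $\Delta_{\mathbf s}(k)=k(k-1)+\sum_{i=k+1}^{p}\min\{k,a_i\}-\sum_{i=1}^{k}a_i$. -}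

module Defs where

open import Data.Bool using (Bool; true; false; if_then_else_; _∧_)
open import Data.Nat as ℕ using (ℕ; zero; suc; _<ᵇ_; _⊓_; _%_)
open import Data.Fin using (Fin; toℕ)
open import Data.Nat.ListAction using (sum)
open import Data.List using (List; []; _∷_; map; take; drop; upTo; allFin; foldr; tabulate)
open import Data.Integer as ℤ using (ℤ; +_; -_; _⊔_; ∣_∣)
open import Data.Integer.DivMod using (_/ℕ_)
open import Relation.Binary.PropositionalEquality using (_≡_)

record SimpleGraph (m : ℕ) : Set where
  field
    adj    : Fin m → Fin m → Bool
    sym    : ∀ i j → adj i j ≡ adj j i
    irrefl : ∀ i → adj i i ≡ false

open SimpleGraph public

bool→ℕ : Bool → ℕ
bool→ℕ true  = 1
bool→ℕ false = 0

degree : ∀ {m} → SimpleGraph m → Fin m → ℕ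
degree {m} G i = sum (map (λ j → bool→ℕ (adj G i j)) (allFin m))

numEdges : ∀ {m} → SimpleGraph m → ℕ
numEdges {m} G =
  sum (map (λ i → sum (map (λ j → bool→ℕ (adj G i j ∧ (toℕ i <ᵇ toℕ j))) (allFin m)))
           (allFin m))

HasDegreeSet : ∀ {m n} → SimpleGraph m → (Fin n → ℕ) → Set
HasDegreeSet {m} {n} G d =
  (∀ (v : Fin m) → Σ' (Fin n) (λ i → degree G v ≡ d i)) ×' (∀ (i : Fin n) → Σ' (Fin m) (λ v → degree G v ≡ d i))
  where
    open import Data.Product using () renaming (Σ to Σ'; _×_ to _×'_)

Δ : List ℕ → ℕ → ℤ
Δ s k = + (k ℕ.* (k ℕ.∸ 1)) ℤ.+ + sum (map (k ⊓_) (drop k s)) ℤ.- + sum (take k s)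

-- ⌈ a / b ⌉ for b > 0 (junk value 0 when b = 0)
ceilDiv : ℤ → ℕ → ℤ
ceilDiv a zero    = + 0
ceilDiv a (suc b) = - ((- a) /ℕ suc b)

-- maximum of f over k = 1, …, m  (for m ≥ 1)
max1to : (ℕ → ℤ) → ℕ → ℤ
max1to f m = foldr _⊔_ (f 1) (map (λ k → f (suc k)) (upTo m))

evenℤ : ℤ → Bool
evenℤ x = (∣ x ∣ % 2) ℕ.≡ᵇ 0

evenℕ : ℕ → Bool
evenℕ x = (x % 2) ℕ.≡ᵇ 0

-- Data attached to D = {d 0 > d 1 > ⋯ > d m}  (so n = m + 1, d_n = d (fromℕ m))

module _ {m : ℕ} (d : Fin (suc m) → ℕ) where
  open import Data.Fin using (fromℕ)

  dLast : ℕ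
  dLast = d (fromℕ m)

  seq : List ℕ
  seq = tabulate d

  σ : ℕ
  σ = sum seq

  cConst : ℤ
  cConst = max1to (λ k → ceilDiv (- Δ seq k) (k ⊓ dLast)) m

  -- C⋆, by the three cases of the paper; the remaining combination
  -- (d_n even, σ odd) cannot occur under the hypotheses, set to c.
  Cstar : ℤ
  Cstar with evenℕ dLast
  ... | true  = cConst
  ... | false = if evenℤ (+ σ ℤ.+ cConst ℤ.* + dLast) then cConst else cConst ℤ.+ + 1

{-# OPTIONS --safe #-}
module Submission where

-- Write δ = dₙ.  In a graph with degree set D choose vertices of degrees d₁, …, dₙ; every other vertex
-- has degree t δ for some t ≥ 1, and min(k, t δ) ≤ t min(k, δ).  Double counting the edges at the k
-- largest chosen vertices shows that T = Σ t satisfies the inequalities defining c, while the number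
-- of edges is (σ + T δ) / 2; parity then forces T ≥ C⋆.
--
-- Conversely, join i < j (counting from 0) whenever i < d j.  This threshold graph on n vertices has
-- degrees h i ≤ d i with d i − h i ≤ C⋆ and Σ (d i − h i) ≤ C⋆ δ.  Attach the missing d i − h i edges to
-- arbitrary vertices among C⋆ new ones and add edges between vertices of target degree δ until the
-- degree sum is right.  As long as some such u has degree above δ and some such v degree below δ, an
-- edge u w can be replaced by v w, and this ends with all degrees correct.

open import Defs renaming (bool→ℕ to ⟦_⟧; sym to adj-sym; irrefl to adj-irrefl)
open import Data.Bool using (Bool; true; false; if_then_else_; _∧_; _∨_)
open import Data.Bool.Properties using (∧-comm; ∨-comm; ∧-conicalˡ; ∧-conicalʳ)
open import Data.Fin using (Fin; zero; suc; toℕ; fromℕ; fromℕ<; inject; splitAt; _↑ˡ_; _↑ʳ_; _≟_)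
open import Data.Fin.Properties as Fin using (toℕ-injective; toℕ-fromℕ<; toℕ-fromℕ; toℕ-inject; toℕ<n; splitAt-↑ˡ; splitAt-↑ʳ; splitAt⁻¹-↑ˡ; any?; all?; ¬∀⟶∃¬-smallest)
open import Data.List using (tabulate; map; allFin; take; drop; foldr; applyUpTo)
open import Data.List.Properties using (map-tabulate)
import Data.Nat.ListAction as List
open import Data.Nat as ℕ using (ℕ; zero; suc; NonZero; >-nonZero; _≤_; _<_; _>_; _*_; _+_; _∸_; _⊓_; _<?_; _≤?_; _<ᵇ_; z≤n; s≤s; s≤s⁻¹; z<s)
open import Data.Nat.Properties hiding (_≟_)
open import Data.Nat.Divisibility using (_∣_; divides; quotient; _∣0; ∣-trans; ∣m∣n⇒∣m+n; ∣n⇒∣m*n; m%n≡0⇒n∣m; n∣m⇒m%n≡0)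
open import Data.Nat.DivMod using (_%_; m%n<n; %-distribˡ-+)
open import Data.Product using (Σ; _×_; ∃; ∃₂; _,_; proj₁; proj₂)
open import Data.Sum using (_⊎_; inj₁; inj₂; [_,_]′)
open import Function using (_∘_)
open import Relation.Binary.Definitions using (Tri; tri<; tri≈; tri>)
open import Relation.Binary.PropositionalEquality using (_≡_; _≢_; refl; sym; trans; cong; cong₂; subst; subst₂; module ≡-Reasoning)
open import Relation.Nullary using (Dec; yes; no; does; ¬_; contradiction)
open import Relation.Nullary.Decidable using (dec-true; dec-false)

open import Algebra.Properties.Semiring.Sum +-*-semiring using (sum; sum-syntax; sum-cong-≗; ∑-distrib-+; ∑-comm; *-distribˡ-sum; *-distribʳ-sum)

𝟙 : ∀ {a} {P : Set a} → Dec P → ℕ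
𝟙 P? = ⟦ does P? ⟧

-- Finite sums

sum-mono-≤ : ∀ {n} {f g : Fin n → ℕ} → (∀ i → f i ≤ g i) → sum f ≤ sum g
sum-mono-≤ {zero}  f≤g = z≤n
sum-mono-≤ {suc n} f≤g = +-mono-≤ (f≤g zero) (sum-mono-≤ (f≤g ∘ suc))

sum-mono-< : ∀ {n} {f g : Fin n → ℕ} → (∀ i → f i ≤ g i) → ∀ u → f u < g u → sum f < sum g
sum-mono-< f≤g zero    fu<gu = +-mono-<-≤ fu<gu (sum-mono-≤ (f≤g ∘ suc))
sum-mono-< f≤g (suc u) fu<gu = +-mono-≤-< (f≤g zero) (sum-mono-< (f≤g ∘ suc) u fu<gu)

sum-<⇒∃< : ∀ {n} {f g : Fin n → ℕ} → sum f < sum g → ∃ λ i → f i < g i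
sum-<⇒∃< {f = f} {g} ∑f<∑g with any? (λ i → f i <? g i)
... | yes p = p
... | no ¬p = contradiction ∑f<∑g (≤⇒≯ (sum-mono-≤ λ i → ≮⇒≥ λ fi<gi → ¬p (i , fi<gi)))

-- With equal sums, an excess at one index forces a shortfall at another. Applied to actual and
-- target degrees, this either finishes the construction or yields the two vertices for the next
-- edge move.
sum-≡⇒≗⊎∃ : ∀ {n} {f g : Fin n → ℕ} → sum f ≡ sum g →
            (∀ i → f i ≡ g i) ⊎ (∃₂ λ u v → g u < f u × f v < g v)
sum-≡⇒≗⊎∃ {f = f} {g} ∑f≡∑g with any? (λ i → f i <? g i) | any? (λ i → g i <? f i)
... | yes (v , lt) | yes (u , gt) = inj₂ (u , v , gt , lt)
... | yes (v , lt) | no ¬gt =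
  contradiction (sum-mono-< (λ i → ≮⇒≥ λ gt → ¬gt (i , gt)) v lt) (<-irrefl ∑f≡∑g)
... | no ¬lt | yes (u , gt) =
  contradiction (sum-mono-< (λ i → ≮⇒≥ λ lt → ¬lt (i , lt)) u gt) (<-irrefl (sym ∑f≡∑g))
... | no ¬lt | no ¬gt =
  inj₁ λ i → ≤-antisym (≮⇒≥ λ gt → ¬gt (i , gt)) (≮⇒≥ λ lt → ¬lt (i , lt))

sum-const : ∀ n c → sum {n} (λ _ → c) ≡ n * c
sum-const zero    c = refl
sum-const (suc n) c = cong (c +_) (sum-const n c)

≤-sum : ∀ {n} (f : Fin n → ℕ) i → f i ≤ sum f
≤-sum f zero    = m≤m+n _ _
≤-sum f (suc i) = m≤n⇒m≤o+n (f zero) (≤-sum (f ∘ suc) i)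

sum-𝟙≟-* : ∀ {n} (v : Fin n) (f : Fin n → ℕ) → ∑[ w < n ] (𝟙 (w ≟ v) * f w) ≡ f v
sum-𝟙≟-* {suc n} zero f = trans
  (cong₂ _+_ (*-identityˡ (f zero)) (trans (sum-const n 0) (*-zeroʳ n))) (+-identityʳ _)
sum-𝟙≟-* (suc v) f = sum-𝟙≟-* v (f ∘ suc)

sum-𝟙≟ : ∀ {n} (v : Fin n) → ∑[ w < n ] 𝟙 (w ≟ v) ≡ 1
sum-𝟙≟ {n} v = trans (sum-cong-≗ {n} λ w → sym (*-identityʳ _)) (sum-𝟙≟-* v (λ _ → 1))

sum-𝟙< : ∀ n k → ∑[ j < n ] 𝟙 (toℕ j <? k) ≡ k ⊓ n
sum-𝟙< n       zero    = trans (sum-const n 0) (*-zeroʳ n)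
sum-𝟙< zero    (suc k) = refl
sum-𝟙< (suc n) (suc k) = cong suc (sum-𝟙< n k)

*-⟦⟧≤ : ∀ x b → x * ⟦ b ⟧ ≤ x
*-⟦⟧≤ x true  = ≤-reflexive (*-identityʳ x)
*-⟦⟧≤ x false = ≤-trans (≤-reflexive (*-zeroʳ x)) z≤n

1≤⟦true⟧ : ∀ {b} → b ≡ true → 1 ≤ ⟦ b ⟧
1≤⟦true⟧ refl = ≤-refl

𝟙-true : ∀ {P : Set} (P? : Dec P) → P → 𝟙 P? ≡ 1
𝟙-true P? p = cong ⟦_⟧ (dec-true P? p)

𝟙-false : ∀ {P : Set} (P? : Dec P) → ¬ P → 𝟙 P? ≡ 0
𝟙-false P? ¬p = cong ⟦_⟧ (dec-false P? ¬p)

1≤𝟙 : ∀ {P : Set} (P? : Dec P) → P → 1 ≤ 𝟙 P?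
1≤𝟙 P? p = ≤-reflexive (sym (𝟙-true P? p))

𝟙≤ : ∀ {P : Set} {x} (P? : Dec P) → (P → 1 ≤ x) → 𝟙 P? ≤ x
𝟙≤ (yes p) 1≤x = 1≤x p
𝟙≤ (no _)  1≤x = z≤n

∑-split : ∀ {n} k (f : Fin n → ℕ) → sum f ≡ ∑[ i < n ] (𝟙 (toℕ i <? k) * f i) + ∑[ i < n ] (𝟙 (k ≤? toℕ i) * f i)
∑-split {n} k f = trans (sum-cong-≗ {n} pointwise) (∑-distrib-+ {n} _ _)
  where
  pointwise : ∀ i → f i ≡ 𝟙 (toℕ i <? k) * f i + 𝟙 (k ≤? toℕ i) * f i
  pointwise i with <-≤-connex (toℕ i) k
  ... | inj₁ i<k rewrite 𝟙-true (toℕ i <? k) i<k | 𝟙-false (k ≤? toℕ i) (<⇒≱ i<k) =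
    sym (trans (+-identityʳ _) (+-identityʳ _))
  ... | inj₂ k≤i rewrite 𝟙-true (k ≤? toℕ i) k≤i | 𝟙-false (toℕ i <? k) (≤⇒≯ k≤i) = sym (+-identityʳ _)

sum-↑ : ∀ m n (f : Fin (m + n) → ℕ) → sum f ≡ ∑[ i < m ] f (i ↑ˡ n) + ∑[ j < n ] f (m ↑ʳ j)
sum-↑ zero    n f = refl
sum-↑ (suc m) n f = trans (cong (f zero +_) (sum-↑ m n (f ∘ suc))) (sym (+-assoc (f zero) _ _))

does-true⇒ : ∀ {P : Set} (P? : Dec P) → does P? ≡ true → P
does-true⇒ (yes p) _ = p

sum-⟦⟧-unique : ∀ {n} (b : Fin n → Bool) → (∀ {i j} → b i ≡ true → b j ≡ true → i ≡ j) →
                ∑[ i < n ] ⟦ b i ⟧ ≤ 1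
sum-⟦⟧-unique {zero}  b unique = z≤n
sum-⟦⟧-unique {suc n} b unique with b zero in b₀
... | false = sum-⟦⟧-unique (b ∘ suc) λ p q → Fin.suc-injective (unique p q)
... | true  = s≤s (≤-reflexive (trans (sum-cong-≗ others) (trans (sum-const n 0) (*-zeroʳ n))))
  where
  others : ∀ i → ⟦ b (suc i) ⟧ ≡ 0
  others i with b (suc i) in bᵢ
  ... | false = refl
  ... | true  with () ← unique b₀ bᵢ

-- Double counting of the pairs `(i, x)` with `b i` true and `x = g i`: each selected `i` gives such
-- a pair because `g i < N`, and each `x` lies in at most one because `g` is injective on the
-- selection.
sum-⟦⟧-injection : ∀ {n} (b : Fin n → Bool) (g : Fin n → ℕ) N → (∀ {i} → b i ≡ true → g i < N) →
                   (∀ {i j} → b i ≡ true → b j ≡ true → g i ≡ g j → i ≡ j) →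
                   ∑[ i < n ] ⟦ b i ⟧ ≤ N
sum-⟦⟧-injection {n} b g N bound inj = begin
  ∑[ i < n ] ⟦ b i ⟧               ≤⟨ sum-mono-≤ row ⟩
  ∑[ i < n ] ∑[ x < N ] ⟦ c i x ⟧  ≡⟨ ∑-comm (λ i x → ⟦ c i x ⟧) ⟩
  ∑[ x < N ] ∑[ i < n ] ⟦ c i x ⟧  ≤⟨ sum-mono-≤ (λ x → sum-⟦⟧-unique (λ i → c i x) (column x)) ⟩
  ∑[ x < N ] 1                     ≡⟨ sum-const N 1 ⟩
  N * 1                            ≡⟨ *-identityʳ N ⟩
  N                                ∎
  where
  open ≤-Reasoning
  c : Fin n → Fin N → Bool
  c i x = b i ∧ does (toℕ x ℕ.≟ g i)
  row : ∀ i → ⟦ b i ⟧ ≤ ∑[ x < N ] ⟦ c i x ⟧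
  row i with b i in bᵢ
  ... | false = z≤n
  ... | true  = ≤-trans
    (≤-reflexive (sym (𝟙-true (toℕ (fromℕ< (bound bᵢ)) ℕ.≟ g i) (toℕ-fromℕ< (bound bᵢ)))))
    (≤-sum (λ x → 𝟙 (toℕ x ℕ.≟ g i)) (fromℕ< (bound bᵢ)))
  split : ∀ i x → c i x ≡ true → b i ≡ true × toℕ x ≡ g i
  split i x eq with b i
  ... | true = refl , does-true⇒ (toℕ x ℕ.≟ g i) eq
  column : ∀ x {i j} → c i x ≡ true → c j x ≡ true → i ≡ j
  column x {i} {j} p q with bᵢ , xᵢ ← split i x p | bⱼ , xⱼ ← split j x q = inj bᵢ bⱼ (trans (sym xᵢ) xⱼ)

List-sum-tabulate : ∀ {n} (f : Fin n → ℕ) → List.sum (tabulate f) ≡ sum f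
List-sum-tabulate {zero}  f = refl
List-sum-tabulate {suc n} f = cong (f zero +_) (List-sum-tabulate (f ∘ suc))

List-sum-allFin : ∀ n (f : Fin n → ℕ) → List.sum (map f (allFin n)) ≡ sum f
List-sum-allFin n f = trans (cong List.sum (map-tabulate (λ i → i) f)) (List-sum-tabulate f)

-- Degrees

degree≡∑ : ∀ {n} (G : SimpleGraph n) i → degree G i ≡ ∑[ j < n ] ⟦ adj G i j ⟧
degree≡∑ {n} G i = List-sum-allFin n (λ j → ⟦ adj G i j ⟧)

adj⇒≢ : ∀ {n} (G : SimpleGraph n) {i j} → adj G i j ≡ true → i ≢ j
adj⇒≢ G {i} ij refl with () ← trans (sym ij) (adj-irrefl G i)

-- `numEdges` sums the adjacency matrix above the diagonal. Transposing one of two copies gives the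
-- part below, and on an edge exactly one of the two comparisons of indices holds.
handshake : ∀ {n} (G : SimpleGraph n) → 2 * numEdges G ≡ ∑[ i < n ] degree G i
handshake {n} G = begin
  2 * numEdges G                                              ≡⟨ cong (numEdges G +_) (+-identityʳ _) ⟩
  numEdges G + numEdges G                                     ≡⟨ cong₂ _+_ numEdges≡ numEdges≡ ⟩
  ∑[ i < n ] ∑[ j < n ] up i j + ∑[ i < n ] ∑[ j < n ] up i j ≡⟨ cong (∑[ i < n ] ∑[ j < n ] up i j +_) (∑-comm up) ⟩
  ∑[ i < n ] ∑[ j < n ] up i j + ∑[ i < n ] ∑[ j < n ] up j i ≡⟨ ∑-distrib-+ {n} _ _ ⟨
  ∑[ i < n ] (∑[ j < n ] up i j + ∑[ j < n ] up j i)          ≡⟨ sum-cong-≗ (λ i → sym (∑-distrib-+ (up i) _)) ⟩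
  ∑[ i < n ] ∑[ j < n ] (up i j + up j i)                     ≡⟨ sum-cong-≗ (λ i → sum-cong-≗ (split i)) ⟩
  ∑[ i < n ] ∑[ j < n ] ⟦ adj G i j ⟧                         ≡⟨ sum-cong-≗ (degree≡∑ G) ⟨
  ∑[ i < n ] degree G i                                       ∎
  where
  open ≡-Reasoning
  up : Fin n → Fin n → ℕ
  up i j = ⟦ adj G i j ∧ (toℕ i <ᵇ toℕ j) ⟧
  numEdges≡ : numEdges G ≡ ∑[ i < n ] ∑[ j < n ] up i j
  numEdges≡ = trans (List-sum-allFin n _) (sum-cong-≗ λ i → List-sum-allFin n (up i))
  <ᵇ-exclusive : ∀ a b → a ≢ b → ⟦ a <ᵇ b ⟧ + ⟦ b <ᵇ a ⟧ ≡ 1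
  <ᵇ-exclusive zero    zero    a≢b = contradiction refl a≢b
  <ᵇ-exclusive zero    (suc b) a≢b = refl
  <ᵇ-exclusive (suc a) zero    a≢b = refl
  <ᵇ-exclusive (suc a) (suc b) a≢b = <ᵇ-exclusive a b (a≢b ∘ cong suc)
  split : ∀ i j → up i j + up j i ≡ ⟦ adj G i j ⟧
  split i j rewrite adj-sym G j i with adj G i j in eq
  ... | false = refl
  ... | true  = <ᵇ-exclusive (toℕ i) (toℕ j) λ i≡j → adj⇒≢ G eq (toℕ-injective i≡j)

-- Adding, deleting and moving single edges

onEdge : ∀ {n} → Fin n → Fin n → Fin n → Fin n → Bool
onEdge a b i j = (does (i ≟ a) ∧ does (j ≟ b)) ∨ (does (i ≟ b) ∧ does (j ≟ a))

setEdge : ∀ {n} → SimpleGraph n → ∀ {a b : Fin n} → a ≢ b → Bool → SimpleGraph n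
setEdge {n} G {a} {b} a≢b c = record
  { adj    = λ i j → if onEdge a b i j then c else adj G i j
  ; sym    = λ i j → cong₂ (if_then c else_) (onEdge-sym i j) (adj-sym G i j)
  ; irrefl = λ i → trans (cong (if_then c else adj G i i) (off i)) (adj-irrefl G i)
  }
  where
  onEdge-sym : ∀ i j → onEdge a b i j ≡ onEdge a b j i
  onEdge-sym i j = trans (∨-comm (does (i ≟ a) ∧ does (j ≟ b)) _)
    (cong₂ _∨_ (∧-comm (does (i ≟ b)) _) (∧-comm (does (i ≟ a)) _))
  off : ∀ i → onEdge a b i i ≡ false
  off i with i ≟ a | i ≟ b
  ... | yes p | yes q = contradiction (trans (sym p) q) a≢b
  ... | yes _ | no  _ = refl
  ... | no  _ | yes _ = refl
  ... | no  _ | no  _ = refl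

-- Both sides carry the contribution of the pair {a, b}, so that no subtraction occurs.
degree-setEdge : ∀ {n} (G : SimpleGraph n) {a b : Fin n} (a≢b : a ≢ b) c i →
                 degree (setEdge G a≢b c) i + ⟦ adj G a b ⟧ * (𝟙 (i ≟ a) + 𝟙 (i ≟ b)) ≡
                 degree G i + ⟦ c ⟧ * (𝟙 (i ≟ a) + 𝟙 (i ≟ b))
degree-setEdge {n} G {a} {b} a≢b c i = begin
  degree G′ i + x * (𝟙 (i ≟ a) + 𝟙 (i ≟ b))           ≡⟨ cong₂ _+_ (degree≡∑ G′ i) (sym (∑e x)) ⟩
  ∑[ j < n ] ⟦ adj G′ i j ⟧ + ∑[ j < n ] (x * e j)    ≡⟨ ∑-distrib-+ {n} _ _ ⟨
  ∑[ j < n ] (⟦ adj G′ i j ⟧ + x * e j)               ≡⟨ sum-cong-≗ {n} pointwise ⟩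
  ∑[ j < n ] (⟦ adj G i j ⟧ + ⟦ c ⟧ * e j)            ≡⟨ ∑-distrib-+ {n} _ _ ⟩
  ∑[ j < n ] ⟦ adj G i j ⟧ + ∑[ j < n ] (⟦ c ⟧ * e j) ≡⟨ cong₂ _+_ (sym (degree≡∑ G i)) (∑e ⟦ c ⟧) ⟩
  degree G i + ⟦ c ⟧ * (𝟙 (i ≟ a) + 𝟙 (i ≟ b))        ∎
  where
  open ≡-Reasoning
  G′ = setEdge G a≢b c
  x = ⟦ adj G a b ⟧
  e : Fin n → ℕ
  e j = 𝟙 (i ≟ a) * 𝟙 (j ≟ b) + 𝟙 (i ≟ b) * 𝟙 (j ≟ a)
  one : ∀ y (v : Fin n) → ∑[ j < n ] (y * 𝟙 (j ≟ v)) ≡ y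
  one y v = trans (sym (*-distribˡ-sum {n} y _)) (trans (cong (y *_) (sum-𝟙≟ v)) (*-identityʳ y))
  ∑e : ∀ y → ∑[ j < n ] (y * e j) ≡ y * (𝟙 (i ≟ a) + 𝟙 (i ≟ b))
  ∑e y = trans (sym (*-distribˡ-sum {n} y e))
    (cong (y *_) (trans (∑-distrib-+ {n} _ _) (cong₂ _+_ (one (𝟙 (i ≟ a)) b) (one (𝟙 (i ≟ b)) a))))
  unchanged : ∀ j → ⟦ adj G i j ⟧ + x * 0 ≡ ⟦ adj G i j ⟧ + ⟦ c ⟧ * 0
  unchanged j = cong (⟦ adj G i j ⟧ +_) (trans (*-zeroʳ x) (sym (*-zeroʳ ⟦ c ⟧)))
  pointwise : ∀ j → ⟦ adj G′ i j ⟧ + x * e j ≡ ⟦ adj G i j ⟧ + ⟦ c ⟧ * e j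
  pointwise j with i ≟ a | j ≟ b | i ≟ b | j ≟ a
  ... | yes i≡a  | _        | yes i≡b  | _        = contradiction (trans (sym i≡a) i≡b) a≢b
  ... | _        | yes j≡b  | _        | yes j≡a  = contradiction (trans (sym j≡a) j≡b) a≢b
  ... | yes refl | yes refl | no _     | no _     =
    trans (+-comm ⟦ c ⟧ _) (cong₂ _+_ (*-identityʳ x) (sym (*-identityʳ ⟦ c ⟧)))
  ... | no _     | no _     | yes refl | yes refl = trans (+-comm ⟦ c ⟧ _)
    (cong₂ _+_ (trans (*-identityʳ x) (cong ⟦_⟧ (adj-sym G a b))) (sym (*-identityʳ ⟦ c ⟧)))
  ... | yes _    | no _     | no _     | no _     = unchanged j
  ... | yes _    | no _     | no _     | yes _    = unchanged j
  ... | no _     | yes _    | no _     | no _     = unchanged j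
  ... | no _     | yes _    | yes _    | no _     = unchanged j
  ... | no _     | no _     | yes _    | no _     = unchanged j
  ... | no _     | no _     | no _     | _        = unchanged j

-- The vertex `u` and its neighbours number `suc (degree G u)`, so a larger set has a member
-- outside.
nonneighbour : ∀ {n} (G : SimpleGraph n) u (P : Fin n → Bool) → suc (degree G u) < ∑[ w < n ] ⟦ P w ⟧ →
               ∃ λ w → P w ≡ true × w ≢ u × adj G u w ≡ false
nonneighbour {n} G u P more = w , found w (proj₂ candidate)
  where
  ∑closed : ∑[ w < n ] (⟦ adj G u w ⟧ + 𝟙 (w ≟ u)) ≡ suc (degree G u)
  ∑closed = trans (∑-distrib-+ {n} _ _)
    (trans (cong₂ _+_ (sym (degree≡∑ G u)) (sum-𝟙≟ u)) (+-comm (degree G u) 1))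
  candidate : ∃ λ w → ⟦ adj G u w ⟧ + 𝟙 (w ≟ u) < ⟦ P w ⟧
  candidate = sum-<⇒∃< (subst (_< ∑[ w < n ] ⟦ P w ⟧) (sym ∑closed) more)
  w = proj₁ candidate
  found : ∀ w → ⟦ adj G u w ⟧ + 𝟙 (w ≟ u) < ⟦ P w ⟧ → P w ≡ true × w ≢ u × adj G u w ≡ false
  found w lt with P w | adj G u w | w ≟ u
  found w lt         | true  | false | no w≢u = refl , w≢u , refl
  found w (s≤s ())   | true  | false | yes _
  found w (s≤s ())   | true  | true  | _
  found w ()         | false | _     | _

degree-addEdge : ∀ {n} (G : SimpleGraph n) {a b : Fin n} (a≢b : a ≢ b) → adj G a b ≡ false → ∀ i →
                 degree (setEdge G a≢b true) i ≡ degree G i + (𝟙 (i ≟ a) + 𝟙 (i ≟ b))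
degree-addEdge G {a} {b} a≢b ab i
  with eq ← degree-setEdge G a≢b true i rewrite ab =
  trans (sym (+-identityʳ _)) (trans eq (cong (degree G i +_) (*-identityˡ _)))

degree-removeEdge : ∀ {n} (G : SimpleGraph n) {a b : Fin n} (a≢b : a ≢ b) → adj G a b ≡ true → ∀ i →
                    degree (setEdge G a≢b false) i + (𝟙 (i ≟ a) + 𝟙 (i ≟ b)) ≡ degree G i
degree-removeEdge G {a} {b} a≢b ab i
  with eq ← degree-setEdge G a≢b false i rewrite ab =
  trans (cong (degree (setEdge G a≢b false) i +_) (sym (*-identityˡ _))) (trans eq (+-identityʳ _))

-- The gap of two leaves, among the neighbours of `u`, some `w` that is neither `v` nor adjacent to
-- `v`. Adding `v w` and deleting `u w` does not change the degree of `w`, so its indicator cancels.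
moveEdge : ∀ {n} (G : SimpleGraph n) u v → suc (degree G v) < degree G u →
           ∃ λ H → ∀ i → degree H i + 𝟙 (i ≟ u) ≡ degree G i + 𝟙 (i ≟ v)
moveEdge {n} G u v gap
  with w , uw , w≢v , vw ← nonneighbour G v (adj G u) (subst (suc (degree G v) <_) (degree≡∑ G u) gap)
  = H , λ i → +-cancelʳ-≡ (𝟙 (i ≟ w)) _ _ (begin
      degree H i + 𝟙 (i ≟ u) + 𝟙 (i ≟ w)   ≡⟨ +-assoc (degree H i) _ _ ⟩
      degree H i + (𝟙 (i ≟ u) + 𝟙 (i ≟ w)) ≡⟨ degree-removeEdge G₁ (adj⇒≢ G uw) uw₁ i ⟩
      degree G₁ i                          ≡⟨ degree-addEdge G (w≢v ∘ sym) vw i ⟩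
      degree G i + (𝟙 (i ≟ v) + 𝟙 (i ≟ w)) ≡⟨ +-assoc (degree G i) _ _ ⟨
      degree G i + 𝟙 (i ≟ v) + 𝟙 (i ≟ w)   ∎)
  where
  open ≡-Reasoning
  G₁ = setEdge G (w≢v ∘ sym) true
  H = setEdge G₁ (adj⇒≢ G uw) false
  uw₁ : adj G₁ u w ≡ true
  -- Inserting `v w` cannot destroy `u w`: adjacency becomes `true` on the inserted pair and is
  -- unchanged elsewhere.
  uw₁ with onEdge v w u w
  ... | true  = refl
  ... | false = uw

-- Realizing prescribed degrees

module _ {n} (t : Fin n → ℕ) (δ : ℕ) where

  private
    deficiency : SimpleGraph n → ℕ
    deficiency G = ∑[ i < n ] (t i ∸ degree G i)

    -- Errors are confined to vertices with target `δ`. Hence a vertex with too many edges and one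
    -- with too few share this target, and their degrees differ by at least two, as `moveEdge`
    -- requires.
    Exact : SimpleGraph n → Set
    Exact G = ∀ i → t i ≢ δ → degree G i ≡ t i

    δ-valued : ∀ G → Exact G → ∀ i → degree G i ≢ t i → t i ≡ δ
    δ-valued G exact i ≢t with t i ℕ.≟ δ
    ... | yes t≡δ = t≡δ
    ... | no  t≢δ = contradiction (exact i t≢δ) ≢t

  -- Induction on a bound for the total deficiency. Each move lowers it: `v` lacks one edge less,
  -- and `u`, having started above its target, does not fall below it.
  balance : ∀ k (G : SimpleGraph n) → deficiency G ≤ k → ∑[ i < n ] degree G i ≡ sum t → Exact G →
            ∃ λ H → ∀ i → degree H i ≡ t i
  balance k G def≤k ∑≡ exact with sum-≡⇒≗⊎∃ ∑≡
  ... | inj₁ deg≡t = G , deg≡t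
  ... | inj₂ (u , v , tu<du , dv<tv) =
    step (moveEdge G u v (≤-trans (s≤s dv<tv) (subst (λ x → suc x ≤ degree G u) (trans tu≡δ (sym tv≡δ)) tu<du)))
    where
    tu≡δ = δ-valued G exact u (>⇒≢ tu<du)
    tv≡δ = δ-valued G exact v (<⇒≢ dv<tv)
    step : (∃ λ H → ∀ i → degree H i + 𝟙 (i ≟ u) ≡ degree G i + 𝟙 (i ≟ v)) →
           ∃ λ H → ∀ i → degree H i ≡ t i
    step (H , deg-H) = descend k def≤k
      where
      -- Truncated subtraction makes `u` contribute zero both before and after the move.
      pointwise : ∀ i → t i ∸ degree H i + 𝟙 (i ≟ v) ≤ t i ∸ degree G i
      pointwise i with i ≟ u | i ≟ v | deg-H i
      ... | yes refl | yes refl | _  = contradiction tu<du (<-asym dv<tv)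
      ... | yes refl | no _     | eq = ≤-reflexive (trans (+-identityʳ _) (trans (m≤n⇒m∸n≡0 (s≤s⁻¹ tu<dH)) (sym (m≤n⇒m∸n≡0 (<⇒≤ tu<du)))))
        where
        tu<dH : t u < suc (degree H u)
        tu<dH = subst (t u <_) (trans (sym (+-identityʳ _)) (trans (sym eq) (+-comm _ 1))) tu<du
      ... | no _     | yes refl | eq = ≤-reflexive (trans (cong (λ x → t v ∸ x + 1) dH)
                                         (trans (+-comm _ 1) (sym (+-∸-assoc 1 dv<tv))))
        where
        dH : degree H v ≡ suc (degree G v)
        dH = trans (sym (+-identityʳ _)) (trans eq (+-comm _ 1))
      ... | no _     | no _     | eq = ≤-reflexive (trans (+-identityʳ _)
                                         (cong (t i ∸_) (trans (sym (+-identityʳ _)) (trans eq (+-identityʳ _)))))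
      decreases : suc (deficiency H) ≤ deficiency G
      decreases = begin
        suc (deficiency H)                            ≡⟨ +-comm 1 _ ⟩
        deficiency H + 1                              ≡⟨ cong (deficiency H +_) (sum-𝟙≟ v) ⟨
        deficiency H + ∑[ i < n ] 𝟙 (i ≟ v)           ≡⟨ ∑-distrib-+ {n} _ _ ⟨
        ∑[ i < n ] (t i ∸ degree H i + 𝟙 (i ≟ v))     ≤⟨ sum-mono-≤ pointwise ⟩
        deficiency G                                  ∎
        where open ≤-Reasoning
      ∑H≡ : ∑[ i < n ] degree H i ≡ sum t
      ∑H≡ = +-cancelʳ-≡ 1 _ _ (begin
        ∑[ i < n ] degree H i + 1                      ≡⟨ cong (∑[ i < n ] degree H i +_) (sum-𝟙≟ u) ⟨
        ∑[ i < n ] degree H i + ∑[ i < n ] 𝟙 (i ≟ u)   ≡⟨ ∑-distrib-+ {n} _ _ ⟨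
        ∑[ i < n ] (degree H i + 𝟙 (i ≟ u))            ≡⟨ sum-cong-≗ {n} deg-H ⟩
        ∑[ i < n ] (degree G i + 𝟙 (i ≟ v))            ≡⟨ ∑-distrib-+ {n} _ _ ⟩
        ∑[ i < n ] degree G i + ∑[ i < n ] 𝟙 (i ≟ v)   ≡⟨ cong₂ _+_ ∑≡ (sum-𝟙≟ v) ⟩
        sum t + 1                                      ∎)
        where open ≡-Reasoning
      exact-H : Exact H
      exact-H i t≢δ with i ≟ u | i ≟ v | deg-H i
      ... | yes refl | _        | _  = contradiction tu≡δ t≢δ
      ... | no _     | yes refl | _  = contradiction tv≡δ t≢δ
      ... | no _     | no _     | eq =
        trans (sym (+-identityʳ _)) (trans eq (trans (+-identityʳ _) (exact i t≢δ)))
      descend : ∀ k → deficiency G ≤ k → ∃ λ H → ∀ i → degree H i ≡ t i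
      descend zero    def≤0 = contradiction (≤-trans decreases def≤0) λ ()
      descend (suc k) def≤k = balance k H (s≤s⁻¹ (≤-trans decreases def≤k)) ∑H≡ exact-H

  -- `k` is the number of edges still missing. A vertex `u` below its target has target `δ` and so
  -- fewer than `δ` neighbours, while more than `δ` vertices have that target; one of them is a
  -- possible new neighbour. It may overshoot its target, which `balance` repairs at the end.
  fill : ∀ k (G : SimpleGraph n) → ∑[ i < n ] degree G i + 2 * k ≡ sum t → Exact G →
         δ < ∑[ i < n ] 𝟙 (t i ℕ.≟ δ) → ∃ λ H → ∀ i → degree H i ≡ t i
  fill zero    G ∑≡ exact room = balance _ G ≤-refl (trans (sym (+-identityʳ _)) ∑≡) exact
  fill (suc k) G ∑≡ exact room = extended (sum-<⇒∃< (subst (∑[ i < n ] degree G i <_) ∑≡ (m<m+n _ z<s)))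
    where
    extended : (∃ λ u → degree G u < t u) → ∃ λ H → ∀ i → degree H i ≡ t i
    extended (u , du<tu) = fill k H ∑H≡ exact-H room
      where
      tu≡δ = δ-valued G exact u (<⇒≢ du<tu)
      partner = nonneighbour G u (λ w → does (t w ℕ.≟ δ)) (≤-<-trans (subst (degree G u <_) tu≡δ du<tu) room)
      w = proj₁ partner
      tw≡δ = does-true⇒ (t w ℕ.≟ δ) (proj₁ (proj₂ partner))
      u≢w = proj₁ (proj₂ (proj₂ partner)) ∘ sym
      H = setEdge G u≢w true
      deg-H = degree-addEdge G u≢w (proj₂ (proj₂ (proj₂ partner)))
      ∑H≡ : ∑[ i < n ] degree H i + 2 * k ≡ sum t
      ∑H≡ = begin
        ∑[ i < n ] degree H i + 2 * k                                  ≡⟨ cong (_+ 2 * k) (sum-cong-≗ {n} deg-H) ⟩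
        ∑[ i < n ] (degree G i + (𝟙 (i ≟ u) + 𝟙 (i ≟ w))) + 2 * k      ≡⟨ cong (_+ 2 * k) (∑-distrib-+ {n} _ _) ⟩
        ∑[ i < n ] degree G i + ∑[ i < n ] (𝟙 (i ≟ u) + 𝟙 (i ≟ w)) + 2 * k
          ≡⟨ cong (λ x → ∑[ i < n ] degree G i + x + 2 * k) (trans (∑-distrib-+ {n} _ _) (cong₂ _+_ (sum-𝟙≟ u) (sum-𝟙≟ w))) ⟩
        ∑[ i < n ] degree G i + 2 + 2 * k                              ≡⟨ +-assoc (∑[ i < n ] degree G i) 2 _ ⟩
        ∑[ i < n ] degree G i + (2 + 2 * k)                            ≡⟨ cong (∑[ i < n ] degree G i +_) (*-suc 2 k) ⟨
        ∑[ i < n ] degree G i + 2 * suc k                              ≡⟨ ∑≡ ⟩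
        sum t                                                          ∎
        where open ≡-Reasoning
      exact-H : Exact H
      exact-H i t≢δ with i ≟ u | i ≟ w | deg-H i
      ... | yes refl | _        | _  = contradiction tu≡δ t≢δ
      ... | no _     | yes refl | _  = contradiction tw≡δ t≢δ
      ... | no _     | no _     | eq = trans eq (trans (+-identityʳ _) (exact i t≢δ))

  -- Both degree sums are even, the present one by `handshake`, so the shortfall is made up by a
  -- whole number of edges.
  realize : (G : SimpleGraph n) → Exact G → ∑[ i < n ] degree G i ≤ sum t → 2 ∣ sum t →
            δ < ∑[ i < n ] 𝟙 (t i ℕ.≟ δ) → ∃ λ H → ∀ i → degree H i ≡ t i
  realize G exact ∑≤ (divides h ∑t≡h*2) room = fill (h ∸ numEdges G) G eq exact room
    where
    open ≡-Reasoning
    ∑t≡2*h : sum t ≡ 2 * h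
    ∑t≡2*h = trans ∑t≡h*2 (*-comm h 2)
    e≤h : numEdges G ≤ h
    e≤h = *-cancelˡ-≤ 2 (subst (2 * numEdges G ≤_) ∑t≡2*h (subst (_≤ sum t) (sym (handshake G)) ∑≤))
    eq : ∑[ i < n ] degree G i + 2 * (h ∸ numEdges G) ≡ sum t
    eq = begin
      ∑[ i < n ] degree G i + 2 * (h ∸ numEdges G)  ≡⟨ cong (_+ 2 * (h ∸ numEdges G)) (handshake G) ⟨
      2 * numEdges G + 2 * (h ∸ numEdges G)         ≡⟨ *-distribˡ-+ 2 (numEdges G) _ ⟨
      2 * (numEdges G + (h ∸ numEdges G))           ≡⟨ cong (2 *_) (m+[n∸m]≡n e≤h) ⟩
      2 * h                                         ≡⟨ ∑t≡2*h ⟨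
      sum t                                         ∎

-- Threshold graphs of decreasing sequences

StrictlyDecreasing : ∀ {n} → (Fin n → ℕ) → Set
StrictlyDecreasing d = ∀ i j → toℕ i < toℕ j → d i > d j

-- Strict decrease of natural numbers costs at least one per index. This form bounds early values
-- below by the last one and later values above by the first.
decreasing-slope : ∀ {n} (d : Fin n → ℕ) → StrictlyDecreasing d →
                   ∀ i j → toℕ i ≤ toℕ j → d j + toℕ j ≤ d i + toℕ i
decreasing-slope d dec zero zero _ = ≤-refl
decreasing-slope {suc (suc n)} d dec zero (suc j) _ = begin
  d (suc j) + suc (toℕ j)  ≡⟨ +-suc _ _ ⟩
  suc (d (suc j) + toℕ j)  ≤⟨ s≤s (decreasing-slope (d ∘ suc) (λ i j i<j → dec (suc i) (suc j) (s≤s i<j)) zero j z≤n) ⟩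
  suc (d (suc zero) + 0)   ≤⟨ +-monoˡ-≤ 0 (dec zero (suc zero) z<s) ⟩
  d zero + 0               ∎
  where open ≤-Reasoning
decreasing-slope d dec (suc i) (suc j) (s≤s i≤j) = begin
  d (suc j) + suc (toℕ j)  ≡⟨ +-suc _ _ ⟩
  suc (d (suc j) + toℕ j)  ≤⟨ s≤s (decreasing-slope (d ∘ suc) (λ i j i<j → dec (suc i) (suc j) (s≤s i<j)) i j i≤j) ⟩
  suc (d (suc i) + toℕ i)  ≡⟨ +-suc _ _ ⟨
  d (suc i) + suc (toℕ i)  ∎
  where open ≤-Reasoning

decreasing⇒antitone : ∀ {n} (d : Fin n → ℕ) → StrictlyDecreasing d → ∀ i j → toℕ i ≤ toℕ j → d j ≤ d i
decreasing⇒antitone d dec i j i≤j with m≤n⇒m<n∨m≡n i≤j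
... | inj₁ i<j = <⇒≤ (dec i j i<j)
... | inj₂ i≡j = ≤-reflexive (cong d (sym (toℕ-injective i≡j)))

decreasing⇒injective : ∀ {n} (d : Fin n → ℕ) → StrictlyDecreasing d → ∀ {i j} → d i ≡ d j → i ≡ j
decreasing⇒injective d dec {i} {j} di≡dj with <-cmp (toℕ i) (toℕ j)
... | tri< i<j _ _ = contradiction (sym di≡dj) (<⇒≢ (dec i j i<j))
... | tri≈ _ i≡j _ = toℕ-injective i≡j
... | tri> _ _ j<i = contradiction di≡dj (<⇒≢ (dec j i j<i))

module Threshold {n} (d : Fin n → ℕ) (dec : StrictlyDecreasing d) where

  link : Fin n → Fin n → Bool
  link i j = does (toℕ i <? toℕ j) ∧ does (toℕ i <? d j)

  threshold : SimpleGraph n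
  threshold = record
    { adj    = λ i j → link i j ∨ link j i
    ; sym    = λ i j → ∨-comm (link i j) (link j i)
    ; irrefl = λ i → cong (λ b → (b ∧ does (toℕ i <? d i)) ∨ (b ∧ does (toℕ i <? d i)))
                          (dec-false (toℕ i <? toℕ i) (<-irrefl refl))
    }

  link-true : ∀ {i j} → toℕ i < toℕ j → toℕ i < d j → link i j ≡ true
  link-true {i} {j} i<j i<dj = cong₂ _∧_ (dec-true (toℕ i <? toℕ j) i<j) (dec-true (toℕ i <? d j) i<dj)

  link⇒ : ∀ i j → link i j ≡ true → toℕ i < toℕ j × toℕ i < d j
  link⇒ i j ij = does-true⇒ (toℕ i <? toℕ j) (∧-conicalˡ _ _ ij) ,
                 does-true⇒ (toℕ i <? d j) (∧-conicalʳ (does (toℕ i <? toℕ j)) _ ij)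

  adj-up : ∀ {i j} → toℕ i < toℕ j → toℕ i < d j → adj threshold i j ≡ true
  adj-up {i} {j} i<j i<dj = cong (_∨ link j i) (link-true i<j i<dj)

  adj-down : ∀ {i j} → toℕ j < toℕ i → toℕ j < d i → adj threshold i j ≡ true
  adj-down {i} {j} j<i j<di = trans (∨-comm (link i j) (link j i)) (adj-up j<i j<di)

  adj⇒ : ∀ i j → adj threshold i j ≡ true → (toℕ i < toℕ j × toℕ i < d j) ⊎ (toℕ j < toℕ i × toℕ j < d i)
  adj⇒ i j ij with link i j in eq
  ... | true  = inj₁ (link⇒ i j eq)
  ... | false = inj₂ (link⇒ j i ij)

  h : Fin n → ℕ
  h i = ∑[ j < n ] ⟦ adj threshold i j ⟧

  -- The neighbours j < i have distinct indices below i, the neighbours j > i distinct values d j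
  -- between i and d i.
  h≤d : ∀ i → h i ≤ d i
  h≤d i = sum-⟦⟧-injection (adj threshold i) g (d i) bound inj
    where
    g : Fin n → ℕ
    g j = if does (toℕ j <? toℕ i) then toℕ j else d j
    g-below : ∀ {j} → toℕ j < toℕ i → g j ≡ toℕ j
    g-below {j} j<i = cong (if_then toℕ j else d j) (dec-true (toℕ j <? toℕ i) j<i)
    g-above : ∀ {j} → toℕ i < toℕ j → g j ≡ d j
    g-above {j} i<j = cong (if_then toℕ j else d j) (dec-false (toℕ j <? toℕ i) (<-asym i<j))
    bound : ∀ {j} → adj threshold i j ≡ true → g j < d i
    bound {j} ij with adj⇒ i j ij
    ... | inj₁ (i<j , _)    = subst (_< d i) (sym (g-above i<j)) (dec i j i<j)
    ... | inj₂ (j<i , j<di) = subst (_< d i) (sym (g-below j<i)) j<di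
    inj : ∀ {j k} → adj threshold i j ≡ true → adj threshold i k ≡ true → g j ≡ g k → j ≡ k
    inj {j} {k} ij ik eq with adj⇒ i j ij | adj⇒ i k ik
    ... | inj₁ (i<j , _) | inj₁ (i<k , _) =
      decreasing⇒injective d dec (trans (sym (g-above i<j)) (trans eq (g-above i<k)))
    ... | inj₂ (j<i , _) | inj₂ (k<i , _) =
      toℕ-injective (trans (sym (g-below j<i)) (trans eq (g-below k<i)))
    ... | inj₁ (i<j , i<dj) | inj₂ (k<i , _) =
      contradiction (trans (sym (g-below k<i)) (trans (sym eq) (g-above i<j))) (<⇒≢ (<-trans k<i i<dj))
    ... | inj₂ (j<i , _) | inj₁ (i<k , i<dk) =
      contradiction (trans (sym (g-below j<i)) (trans eq (g-above i<k))) (<⇒≢ (<-trans j<i i<dk))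

  -- When `d i ≤ toℕ i`, every `j < d i` also precedes `i` and is therefore adjacent to it. Together
  -- with `h≤d`, such vertices are saturated.
  h≥d : ∀ i → d i ≤ toℕ i → d i ≤ h i
  h≥d i di≤i = begin
    d i                              ≡⟨ m≤n⇒m⊓n≡m (≤-trans di≤i (<⇒≤ (toℕ<n i))) ⟨
    d i ⊓ n                          ≡⟨ sum-𝟙< n (d i) ⟨
    ∑[ j < n ] 𝟙 (toℕ j <? d i)      ≤⟨ sum-mono-≤ pointwise ⟩
    h i                              ∎
    where
    open ≤-Reasoning
    pointwise : ∀ j → 𝟙 (toℕ j <? d i) ≤ ⟦ adj threshold i j ⟧
    pointwise j = 𝟙≤ (toℕ j <? d i) λ j<di → 1≤⟦true⟧ (adj-down (<-≤-trans j<di di≤i) j<di)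

  -- If `j ≠ i` and the two indices add up to less than `n`, the hypothesis puts the smaller index
  -- below the value of `d` at the larger, so `i` and `j` are adjacent. This leaves `n ∸ toℕ i`
  -- candidates `j`, of which at most one is `i` itself.
  h-lower : (∀ i → n ≤ d i + toℕ i) → ∀ i → n ≤ suc (h i + toℕ i)
  h-lower n≤d+ i = begin
    n                                                   ≡⟨ m∸n+n≡m (<⇒≤ (toℕ<n i)) ⟨
    n ∸ toℕ i + toℕ i                                   ≡⟨ cong (_+ toℕ i) (m≤n⇒m⊓n≡m (m∸n≤m n (toℕ i))) ⟨
    (n ∸ toℕ i) ⊓ n + toℕ i                             ≡⟨ cong (_+ toℕ i) (sum-𝟙< n (n ∸ toℕ i)) ⟨
    ∑[ j < n ] 𝟙 (toℕ j <? n ∸ toℕ i) + toℕ i           ≤⟨ +-monoˡ-≤ (toℕ i) (sum-mono-≤ pointwise) ⟩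
    ∑[ j < n ] (⟦ adj threshold i j ⟧ + 𝟙 (j ≟ i)) + toℕ i ≡⟨ cong (_+ toℕ i) (∑-distrib-+ {n} _ _) ⟩
    h i + ∑[ j < n ] 𝟙 (j ≟ i) + toℕ i                  ≡⟨ cong (λ x → h i + x + toℕ i) (sum-𝟙≟ i) ⟩
    h i + 1 + toℕ i                                     ≡⟨ cong (_+ toℕ i) (+-comm (h i) 1) ⟩
    suc (h i + toℕ i)                                   ∎
    where
    open ≤-Reasoning
    index-sum : ∀ j → toℕ j < n ∸ toℕ i → toℕ j + toℕ i < n
    index-sum j lt = ≤-trans (+-monoˡ-≤ (toℕ i) lt) (≤-reflexive (m∸n+n≡m (<⇒≤ (toℕ<n i))))
    pointwise : ∀ j → 𝟙 (toℕ j <? n ∸ toℕ i) ≤ ⟦ adj threshold i j ⟧ + 𝟙 (j ≟ i)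
    pointwise j = 𝟙≤ (toℕ j <? n ∸ toℕ i) λ lt → compare lt (<-cmp (toℕ j) (toℕ i))
      where
      compare : toℕ j < n ∸ toℕ i → Tri (toℕ j < toℕ i) (toℕ j ≡ toℕ i) (toℕ j > toℕ i) →
                1 ≤ ⟦ adj threshold i j ⟧ + 𝟙 (j ≟ i)
      compare lt (tri≈ _ j≡i _) = m≤n⇒m≤o+n _ (≤-reflexive (sym (𝟙-true (j ≟ i) (toℕ-injective j≡i))))
      compare lt (tri< j<i _ _) = m≤n⇒m≤n+o _ (1≤⟦true⟧ (adj-down j<i
        (+-cancelʳ-< (toℕ i) _ _ (<-≤-trans (index-sum j lt) (n≤d+ i)))))
      compare lt (tri> _ _ i<j) = m≤n⇒m≤n+o _ (1≤⟦true⟧ (adj-up i<j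
        (+-cancelʳ-< (toℕ j) _ _ (<-≤-trans (subst (_< n) (+-comm (toℕ j) _) (index-sum j lt)) (n≤d+ j)))))

  module _ (K : ℕ) (K≤n : K ≤ n) (durfee : ∀ i → toℕ i < K → toℕ i < d i) where

    private
      top : Fin n → ℕ
      top j = ∑[ i < n ] (𝟙 (toℕ i <? K) * ⟦ adj threshold i j ⟧)

      -- For `i < j < K` the hypothesis `durfee` gives `i < j < d j`, so the first `K` vertices form
      -- a clique.
      top-inside : ∀ j → toℕ j < K → K ∸ 1 ≤ top j
      top-inside j j<K = ≤-trans (∸-monoˡ-≤ 1 K≤) (≤-reflexive (m+n∸n≡m (top j) 1))
        where
        open ≤-Reasoning
        pointwise : ∀ i → 𝟙 (toℕ i <? K) ≤ 𝟙 (toℕ i <? K) * ⟦ adj threshold i j ⟧ + 𝟙 (i ≟ j)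
        pointwise i = 𝟙≤ (toℕ i <? K) λ i<K → compare i<K (<-cmp (toℕ i) (toℕ j))
          where
          compare : toℕ i < K → Tri (toℕ i < toℕ j) (toℕ i ≡ toℕ j) (toℕ i > toℕ j) →
                    1 ≤ 𝟙 (toℕ i <? K) * ⟦ adj threshold i j ⟧ + 𝟙 (i ≟ j)
          compare i<K (tri≈ _ i≡j _) = m≤n⇒m≤o+n _ (≤-reflexive (sym (𝟙-true (i ≟ j) (toℕ-injective i≡j))))
          compare i<K (tri< i<j _ _) = m≤n⇒m≤n+o _ (*-mono-≤ (1≤𝟙 (toℕ i <? K) i<K)
            (1≤⟦true⟧ (adj-up i<j (<-trans i<j (durfee j j<K)))))
          compare i<K (tri> _ _ j<i) = m≤n⇒m≤n+o _ (*-mono-≤ (1≤𝟙 (toℕ i <? K) i<K)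
            (1≤⟦true⟧ (adj-down j<i (<-trans j<i (durfee i i<K)))))
        K≤ : K ≤ top j + 1
        K≤ = begin
          K                                ≡⟨ m≤n⇒m⊓n≡m K≤n ⟨
          K ⊓ n                            ≡⟨ sum-𝟙< n K ⟨
          ∑[ i < n ] 𝟙 (toℕ i <? K)        ≤⟨ sum-mono-≤ pointwise ⟩
          ∑[ i < n ] (𝟙 (toℕ i <? K) * ⟦ adj threshold i j ⟧ + 𝟙 (i ≟ j)) ≡⟨ ∑-distrib-+ {n} _ _ ⟩
          top j + ∑[ i < n ] 𝟙 (i ≟ j)     ≡⟨ cong (top j +_) (sum-𝟙≟ j) ⟩
          top j + 1                        ∎

      top-outside : ∀ j → K ≤ toℕ j → K ⊓ d j ≤ top j
      top-outside j K≤j = begin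
        K ⊓ d j                             ≡⟨ m≤n⇒m⊓n≡m (m≤n⇒m⊓o≤n (d j) K≤n) ⟨
        (K ⊓ d j) ⊓ n                       ≡⟨ sum-𝟙< n (K ⊓ d j) ⟨
        ∑[ i < n ] 𝟙 (toℕ i <? K ⊓ d j)     ≤⟨ sum-mono-≤ pointwise ⟩
        top j                               ∎
        where
        open ≤-Reasoning
        pointwise : ∀ i → 𝟙 (toℕ i <? K ⊓ d j) ≤ 𝟙 (toℕ i <? K) * ⟦ adj threshold i j ⟧
        pointwise i = 𝟙≤ (toℕ i <? K ⊓ d j) λ lt → *-mono-≤ (1≤𝟙 (toℕ i <? K) (m<n⊓o⇒m<n K (d j) lt))
          (1≤⟦true⟧ (adj-up (<-≤-trans (m<n⊓o⇒m<n K (d j) lt) K≤j) (m<n⊓o⇒m<o K (d j) lt)))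

    -- The degrees of the first `K` vertices are counted from the other endpoint, by `top-inside`
    -- and `top-outside`. The left side is the bound of `ErdősGallai` at `K` without the term for
    -- the `C` copies.
    ∑h-top : K * (K ∸ 1) + ∑[ j < n ] (𝟙 (K ≤? toℕ j) * (K ⊓ d j)) ≤ ∑[ i < n ] (𝟙 (toℕ i <? K) * h i)
    ∑h-top = begin
      K * (K ∸ 1) + ∑[ j < n ] (𝟙 (K ≤? toℕ j) * (K ⊓ d j))
        ≡⟨ cong (_+ ∑[ j < n ] (𝟙 (K ≤? toℕ j) * (K ⊓ d j))) ∑const ⟨
      ∑[ j < n ] (𝟙 (toℕ j <? K) * (K ∸ 1)) + ∑[ j < n ] (𝟙 (K ≤? toℕ j) * (K ⊓ d j))
        ≡⟨ ∑-distrib-+ {n} _ _ ⟨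
      ∑[ j < n ] (𝟙 (toℕ j <? K) * (K ∸ 1) + 𝟙 (K ≤? toℕ j) * (K ⊓ d j))
        ≤⟨ sum-mono-≤ pointwise ⟩
      ∑[ j < n ] top j
        ≡⟨ ∑-comm (λ i j → 𝟙 (toℕ i <? K) * ⟦ adj threshold i j ⟧) ⟨
      ∑[ i < n ] ∑[ j < n ] (𝟙 (toℕ i <? K) * ⟦ adj threshold i j ⟧)
        ≡⟨ sum-cong-≗ {n} (λ i → *-distribˡ-sum {n} (𝟙 (toℕ i <? K)) _) ⟨
      ∑[ i < n ] (𝟙 (toℕ i <? K) * h i)
        ∎
      where
      open ≤-Reasoning
      ∑const : ∑[ j < n ] (𝟙 (toℕ j <? K) * (K ∸ 1)) ≡ K * (K ∸ 1)
      ∑const = trans (sym (*-distribʳ-sum {n} (K ∸ 1) (λ j → 𝟙 (toℕ j <? K))))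
        (cong (_* (K ∸ 1)) (trans (sum-𝟙< n K) (m≤n⇒m⊓n≡m K≤n)))
      pointwise : ∀ j → 𝟙 (toℕ j <? K) * (K ∸ 1) + 𝟙 (K ≤? toℕ j) * (K ⊓ d j) ≤ top j
      pointwise j with <-≤-connex (toℕ j) K
      ... | inj₁ j<K rewrite 𝟙-true (toℕ j <? K) j<K | 𝟙-false (K ≤? toℕ j) (<⇒≱ j<K) =
        subst (_≤ top j) (sym (trans (+-identityʳ _) (+-identityʳ _))) (top-inside j j<K)
      ... | inj₂ K≤j rewrite 𝟙-true (K ≤? toℕ j) K≤j | 𝟙-false (toℕ j <? K) (≤⇒≯ K≤j) =
        subst (_≤ top j) (sym (+-identityʳ _)) (top-outside j K≤j)

-- Attaching new vertices

module _ {n} (G : SimpleGraph n) (f : Fin n → ℕ) (C : ℕ) where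

  private
    attachAdj : Fin n ⊎ Fin C → Fin n ⊎ Fin C → Bool
    attachAdj (inj₁ i) (inj₁ j) = adj G i j
    -- Vertex `i` takes the first `f i` new vertices. The degrees of the new vertices may come out
    -- uneven; edge moves correct them afterwards.
    attachAdj (inj₁ i) (inj₂ b) = does (toℕ b <? f i)
    attachAdj (inj₂ b) (inj₁ i) = does (toℕ b <? f i)
    attachAdj (inj₂ _) (inj₂ _) = false

    attachAdj-sym : ∀ x y → attachAdj x y ≡ attachAdj y x
    attachAdj-sym (inj₁ i) (inj₁ j) = adj-sym G i j
    attachAdj-sym (inj₁ _) (inj₂ _) = refl
    attachAdj-sym (inj₂ _) (inj₁ _) = refl
    attachAdj-sym (inj₂ _) (inj₂ _) = refl

    attachAdj-irrefl : ∀ x → attachAdj x x ≡ false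
    attachAdj-irrefl (inj₁ i) = adj-irrefl G i
    attachAdj-irrefl (inj₂ _) = refl

  attach : SimpleGraph (n + C)
  attach = record
    { adj    = λ x y → attachAdj (splitAt n x) (splitAt n y)
    ; sym    = λ x y → attachAdj-sym (splitAt n x) (splitAt n y)
    ; irrefl = λ x → attachAdj-irrefl (splitAt n x)
    }

  private
    ∑attachAdj : ∀ x → ∑[ y < n + C ] ⟦ attachAdj x (splitAt n y) ⟧ ≡
                       ∑[ i < n ] ⟦ attachAdj x (inj₁ i) ⟧ + ∑[ b < C ] ⟦ attachAdj x (inj₂ b) ⟧
    ∑attachAdj x = trans (sum-↑ n C _) (cong₂ _+_
      (sum-cong-≗ {n} λ i → cong (⟦_⟧ ∘ attachAdj x) (splitAt-↑ˡ n i C))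
      (sum-cong-≗ {C} λ b → cong (⟦_⟧ ∘ attachAdj x) (splitAt-↑ʳ n C b)))

  degree-attach-old : ∀ i → degree attach (i ↑ˡ C) ≡ degree G i + f i ⊓ C
  degree-attach-old i rewrite degree≡∑ attach (i ↑ˡ C) | splitAt-↑ˡ n i C =
    trans (∑attachAdj (inj₁ i)) (cong₂ _+_ (sym (degree≡∑ G i)) (sum-𝟙< C (f i)))

  degree-attach-new : ∀ b → degree attach (n ↑ʳ b) ≡ ∑[ i < n ] 𝟙 (toℕ b <? f i)
  degree-attach-new b rewrite degree≡∑ attach (n ↑ʳ b) | splitAt-↑ʳ n C b =
    trans (∑attachAdj (inj₂ b)) (trans (cong (∑[ i < n ] 𝟙 (toℕ b <? f i) +_) (trans (sum-const C 0) (*-zeroʳ C))) (+-identityʳ _))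

  ∑degree-attach-new : ∑[ b < C ] degree attach (n ↑ʳ b) ≡ ∑[ i < n ] (f i ⊓ C)
  ∑degree-attach-new = trans (sum-cong-≗ {C} degree-attach-new)
    (trans (∑-comm {C} {n} (λ b i → 𝟙 (toℕ b <? f i))) (sum-cong-≗ {n} λ i → sum-𝟙< C (f i)))

-- The inequalities at k ≤ n − 1 for the sequence d₁, …, dₙ followed by C further copies of dₙ.
ErdősGallai : ∀ {m} → (Fin (suc m) → ℕ) → ℕ → Set
ErdősGallai {m} d C = ∀ k → 1 ≤ k → k ≤ m →
  ∑[ i < suc m ] (𝟙 (toℕ i <? k) * d i) ≤
  k * (k ∸ 1) + ∑[ i < suc m ] (𝟙 (k ≤? toℕ i) * (k ⊓ d i)) + C * (k ⊓ dLast d)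

-- This is the case `k = 1`: the product `k * (k ∸ 1)` vanishes and each of the other `m + C` terms
-- contributes at most one.
ErdősGallai⇒d₀≤C+m : ∀ {m} → 1 ≤ m → (d : Fin (suc m) → ℕ) → ∀ C → ErdősGallai d C → d zero ≤ C + m
ErdősGallai⇒d₀≤C+m {m} 1≤m d C EG = begin
  -- The indicators of `i ≟ zero` and `toℕ i <? 1` compute to the same values at `zero` and at
  -- successors.
  d zero                                            ≡⟨ sum-𝟙≟-* (zero {m}) d ⟨
  ∑[ i < suc m ] (𝟙 (toℕ i <? 1) * d i)                 ≤⟨ EG 1 ≤-refl 1≤m ⟩
  ∑[ i < suc m ] (𝟙 (1 ≤? toℕ i) * (1 ⊓ d i)) + C * (1 ⊓ dLast d)
    ≤⟨ +-mono-≤ (sum-mono-≤ {m} {g = λ _ → 1} (λ i → ≤-trans (≤-reflexive (+-identityʳ _)) (m⊓n≤m 1 (d (suc i)))))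
                (≤-trans (*-monoʳ-≤ C (m⊓n≤m 1 (dLast d))) (≤-reflexive (*-identityʳ C))) ⟩
  ∑[ i < m ] 1 + C                                  ≡⟨ cong (_+ C) (trans (sum-const m 1) (*-identityʳ m)) ⟩
  m + C                                             ≡⟨ +-comm m C ⟩
  C + m                                             ∎
  where open ≤-Reasoning

-- Sufficiency of the inequalities

module Realization {m} (1≤m : 1 ≤ m) (d : Fin (suc m) → ℕ) (pos : ∀ i → d i > 0)
                   (dec : StrictlyDecreasing d) (C : ℕ) (EG : ErdősGallai d C)
                   (δ≤C : dLast d ≤ C) (even : 2 ∣ sum d + C * dLast d) where

  open Threshold d dec

  private
    n = suc m
    δ = dLast d

  n≤d+i : ∀ i → n ≤ d i + toℕ i
  n≤d+i i = begin
    suc m                          ≤⟨ +-monoˡ-≤ m (pos (fromℕ m)) ⟩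
    δ + m                          ≡⟨ cong (δ +_) (toℕ-fromℕ m) ⟨
    δ + toℕ (fromℕ m)              ≤⟨ decreasing-slope d dec i (fromℕ m) (subst (toℕ i ≤_) (sym (toℕ-fromℕ m)) (s≤s⁻¹ (toℕ<n i))) ⟩
    d i + toℕ i                    ∎
    where open ≤-Reasoning

  -- The first inequality gives `d i + toℕ i ≤ d zero ≤ C + m`, and `h-lower` gives
  -- `m ≤ h i + toℕ i`. So `C` new vertices can absorb the deficit of any single vertex.
  d≤h+C : ∀ i → d i ≤ h i + C
  d≤h+C i = +-cancelʳ-≤ (toℕ i) _ _ (begin
    d i + toℕ i        ≤⟨ decreasing-slope d dec zero i z≤n ⟩
    d zero + 0         ≡⟨ +-identityʳ _ ⟩
    d zero             ≤⟨ ErdősGallai⇒d₀≤C+m 1≤m d C EG ⟩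
    C + m              ≤⟨ +-monoʳ-≤ C (s≤s⁻¹ (h-lower n≤d+i i)) ⟩
    C + (h i + toℕ i)  ≡⟨ +-assoc C (h i) _ ⟨
    C + h i + toℕ i    ≡⟨ cong (_+ toℕ i) (+-comm C (h i)) ⟩
    h i + C + toℕ i    ∎)
    where open ≤-Reasoning

  -- The threshold graph is extremal at its Durfee number K: the vertices i ≥ K are saturated and the
  -- vertices i < K form a clique joined to the others as much as possible, so the inequality at K
  -- alone bounds the total deficit.
  ∑d≤∑h+Cδ : sum d ≤ sum h + C * δ
  ∑d≤∑h+Cδ with all? (λ i → toℕ i <? d i)
  -- Here no index can serve as Durfee number. But then `m < δ`, and bounding each of the `n`
  -- deficits by `C` is enough, since `C * n ≤ C * δ`.
  ... | yes i<d = begin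
    sum d                     ≤⟨ sum-mono-≤ d≤h+C ⟩
    ∑[ i < n ] (h i + C)      ≡⟨ ∑-distrib-+ {n} h (λ _ → C) ⟩
    sum h + ∑[ i < n ] C      ≡⟨ cong (sum h +_) (trans (sum-const n C) (*-comm n C)) ⟩
    sum h + C * n             ≤⟨ +-monoʳ-≤ (sum h) (*-monoʳ-≤ C (subst (_< δ) (toℕ-fromℕ m) (i<d (fromℕ m)))) ⟩
    sum h + C * δ             ∎
    where open ≤-Reasoning
  ... | no ¬i<d = fromDurfee (¬∀⟶∃¬-smallest n (λ i → toℕ i < d i) (λ i → toℕ i <? d i) ¬i<d)
    where
    open ≤-Reasoning
    fromDurfee : (∃ λ i → ¬ toℕ i < d i × (∀ j → toℕ (inject {i = i} j) < d (inject j))) → sum d ≤ sum h + C * δ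
    fromDurfee (i₀ , i₀≮d , below) = begin
      sum d                          ≡⟨ ∑-split K d ⟩
      ∑[ i < n ] (𝟙 (toℕ i <? K) * d i) + ∑[ i < n ] (𝟙 (K ≤? toℕ i) * d i)
        ≤⟨ +-mono-≤ (≤-trans (EG K 1≤K (s≤s⁻¹ (toℕ<n i₀))) (+-mono-≤ (∑h-top K (<⇒≤ (toℕ<n i₀)) inside) (*-monoʳ-≤ C (m⊓n≤n K δ))))
                    (sum-mono-≤ {n} outside) ⟩
      ∑[ i < n ] (𝟙 (toℕ i <? K) * h i) + C * δ + ∑[ i < n ] (𝟙 (K ≤? toℕ i) * h i)
        ≡⟨ +-assoc (∑[ i < n ] (𝟙 (toℕ i <? K) * h i)) (C * δ) _ ⟩
      ∑[ i < n ] (𝟙 (toℕ i <? K) * h i) + (C * δ + ∑[ i < n ] (𝟙 (K ≤? toℕ i) * h i))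
        ≡⟨ cong (∑[ i < n ] (𝟙 (toℕ i <? K) * h i) +_) (+-comm (C * δ) _) ⟩
      ∑[ i < n ] (𝟙 (toℕ i <? K) * h i) + (∑[ i < n ] (𝟙 (K ≤? toℕ i) * h i) + C * δ)
        ≡⟨ +-assoc (∑[ i < n ] (𝟙 (toℕ i <? K) * h i)) _ (C * δ) ⟨
      ∑[ i < n ] (𝟙 (toℕ i <? K) * h i) + ∑[ i < n ] (𝟙 (K ≤? toℕ i) * h i) + C * δ
        ≡⟨ cong (_+ C * δ) (∑-split K h) ⟨
      sum h + C * δ                  ∎
      where
      -- The first index at which `toℕ i < d i` fails. It lies in the range of `EG`: `1 ≤ d i₀ ≤ K`,
      -- and `K ≤ m` because `K` is an index.
      K = toℕ i₀
      d≤K : d i₀ ≤ K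
      d≤K = ≮⇒≥ i₀≮d
      1≤K : 1 ≤ K
      1≤K = ≤-trans (pos i₀) d≤K
      inside : ∀ i → toℕ i < K → toℕ i < d i
      inside i i<K = subst (λ j → toℕ j < d j) (toℕ-injective (trans (toℕ-inject (fromℕ< i<K)) (toℕ-fromℕ< i<K)))
        (below (fromℕ< i<K))
      outside : ∀ i → 𝟙 (K ≤? toℕ i) * d i ≤ 𝟙 (K ≤? toℕ i) * h i
      outside i with <-≤-connex (toℕ i) K
      ... | inj₁ i<K rewrite 𝟙-false (K ≤? toℕ i) (<⇒≱ i<K) = z≤n
      ... | inj₂ K≤i = *-monoʳ-≤ (𝟙 (K ≤? toℕ i))
        (h≥d i (≤-trans (≤-trans (decreasing⇒antitone d dec i₀ i K≤i) d≤K) K≤i))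

  private
    f : Fin n → ℕ
    f i = d i ∸ h i

    f≤C : ∀ i → f i ≤ C
    f≤C i = m≤n+o⇒m∸n≤o (d i) (h i) (d≤h+C i)

    ∑f≤Cδ : sum f ≤ C * δ
    ∑f≤Cδ = +-cancelˡ-≤ (sum h) _ _ (begin
      sum h + sum f               ≡⟨ ∑-distrib-+ {n} h f ⟨
      ∑[ i < n ] (h i + f i)      ≡⟨ sum-cong-≗ {n} (λ i → m+[n∸m]≡n (h≤d i)) ⟩
      sum d                       ≤⟨ ∑d≤∑h+Cδ ⟩
      sum h + C * δ               ∎)
      where open ≤-Reasoning

    G₀ : SimpleGraph (n + C)
    G₀ = attach threshold f C

    value : Fin n ⊎ Fin C → Fin n
    value = [ (λ i → i) , (λ _ → fromℕ m) ]′

    t : Fin (n + C) → ℕ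
    t x = d (value (splitAt n x))

    t-old : ∀ i → t (i ↑ˡ C) ≡ d i
    t-old i = cong (d ∘ value) (splitAt-↑ˡ n i C)

    t-new : ∀ b → t (n ↑ʳ b) ≡ δ
    t-new b = cong (d ∘ value) (splitAt-↑ʳ n C b)

    degree-G₀ : ∀ i → degree G₀ (i ↑ˡ C) ≡ d i
    degree-G₀ i = begin
      degree G₀ (i ↑ˡ C)              ≡⟨ degree-attach-old threshold f C i ⟩
      degree threshold i + f i ⊓ C    ≡⟨ cong₂ _+_ (degree≡∑ threshold i) (m≤n⇒m⊓n≡m (f≤C i)) ⟩
      h i + f i                       ≡⟨ m+[n∸m]≡n (h≤d i) ⟩
      d i                             ∎
      where open ≡-Reasoning

    -- Old vertices already have their final degrees in `G₀`, and every new vertex has target `δ`.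
    exact : ∀ x → t x ≢ δ → degree G₀ x ≡ t x
    exact x t≢δ = split (splitAt n x) refl
      where
      split : ∀ s → splitAt n x ≡ s → degree G₀ x ≡ t x
      split (inj₁ i) eq = subst (λ y → degree G₀ y ≡ t y) (splitAt⁻¹-↑ˡ {n} {i = x} eq) (trans (degree-G₀ i) (sym (t-old i)))
      split (inj₂ b) eq = contradiction (cong (d ∘ value) eq) t≢δ

    ∑t : sum t ≡ sum d + C * δ
    ∑t = trans (sum-↑ n C t) (cong₂ _+_ (sum-cong-≗ {n} t-old) (trans (sum-cong-≗ {C} t-new) (sum-const C δ)))

    ∑degree-G₀ : ∑[ x < n + C ] degree G₀ x ≤ sum t
    ∑degree-G₀ = begin
      ∑[ x < n + C ] degree G₀ x                                          ≡⟨ sum-↑ n C (degree G₀) ⟩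
      ∑[ i < n ] degree G₀ (i ↑ˡ C) + ∑[ b < C ] degree G₀ (n ↑ʳ b)
        ≡⟨ cong₂ _+_ (sum-cong-≗ {n} degree-G₀) (∑degree-attach-new threshold f C) ⟩
      sum d + ∑[ i < n ] (f i ⊓ C)                                        ≤⟨ +-monoʳ-≤ (sum d) (sum-mono-≤ {n} λ i → m⊓n≤m (f i) C) ⟩
      sum d + sum f                                                       ≤⟨ +-monoʳ-≤ (sum d) ∑f≤Cδ ⟩
      sum d + C * δ                                                       ≡⟨ ∑t ⟨
      sum t                                                               ∎
      where open ≤-Reasoning

    -- All `C` new vertices and the old vertex `fromℕ m` have target `δ`, and `C + 1` exceeds `δ` by
    -- `δ≤C`.
    room : δ < ∑[ x < n + C ] 𝟙 (t x ℕ.≟ δ)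
    room = begin
      suc δ                                   ≤⟨ s≤s δ≤C ⟩
      suc C                                   ≡⟨ cong suc (trans (sum-const C 1) (*-identityʳ C)) ⟨
      1 + ∑[ b < C ] 1                        ≤⟨ +-mono-≤
          (≤-trans (1≤𝟙 (t (fromℕ m ↑ˡ C) ℕ.≟ δ) (t-old (fromℕ m))) (≤-sum (λ i → 𝟙 (t (i ↑ˡ C) ℕ.≟ δ)) (fromℕ m)))
          (sum-mono-≤ {C} λ b → 1≤𝟙 (t (n ↑ʳ b) ℕ.≟ δ) (t-new b)) ⟩
      ∑[ i < n ] 𝟙 (t (i ↑ˡ C) ℕ.≟ δ) + ∑[ b < C ] 𝟙 (t (n ↑ʳ b) ℕ.≟ δ)  ≡⟨ sum-↑ n C (λ x → 𝟙 (t x ℕ.≟ δ)) ⟨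
      ∑[ x < n + C ] 𝟙 (t x ℕ.≟ δ)            ∎
      where open ≤-Reasoning

  realization : ∃₂ λ v (G : SimpleGraph v) → HasDegreeSet G d × 2 * numEdges G ≡ sum d + C * δ
  realization = conclude (realize t δ G₀ exact ∑degree-G₀ (subst (2 ∣_) (sym ∑t) even) room)
    where
    conclude : (∃ λ G → ∀ x → degree G x ≡ t x) →
               ∃₂ λ v (G : SimpleGraph v) → HasDegreeSet G d × 2 * numEdges G ≡ sum d + C * δ
    conclude (G , degree-G) = n + C , G ,
      ((λ x → value (splitAt n x) , degree-G x) , (λ i → i ↑ˡ C , trans (degree-G (i ↑ˡ C)) (t-old i))) ,
      trans (handshake G) (trans (sum-cong-≗ {n + C} degree-G) ∑t)

-- Necessity of the Erdős–Gallai inequalities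

module _ {n p} (v : Fin n → Fin p) (v-injective : ∀ {i j} → v i ≡ v j → i ≡ j) where

  private
    hits : Fin p → ℕ
    hits w = ∑[ i < n ] 𝟙 (w ≟ v i)

    hits≤1 : ∀ w → hits w ≤ 1
    hits≤1 w = sum-⟦⟧-unique (λ i → does (w ≟ v i)) λ {i} {j} wi wj →
      v-injective (trans (sym (does-true⇒ (w ≟ v i) wi)) (does-true⇒ (w ≟ v j) wj))

  -- Indicator of the vertices outside the image of `v`; the truncated subtraction is exact because
  -- `hits w ≤ 1`.
  extra : Fin p → ℕ
  extra w = 1 ∸ hits w

  ∑-image : ∀ (f : Fin p → ℕ) → sum f ≡ ∑[ i < n ] f (v i) + ∑[ w < p ] (extra w * f w)
  ∑-image f = begin
    sum f                                                           ≡⟨ sum-cong-≗ {p} pointwise ⟩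
    ∑[ w < p ] (∑[ i < n ] (𝟙 (w ≟ v i) * f w) + extra w * f w)     ≡⟨ ∑-distrib-+ {p} _ _ ⟩
    ∑[ w < p ] ∑[ i < n ] (𝟙 (w ≟ v i) * f w) + ∑[ w < p ] (extra w * f w)
      ≡⟨ cong (_+ ∑[ w < p ] (extra w * f w)) (∑-comm {p} {n} (λ w i → 𝟙 (w ≟ v i) * f w)) ⟩
    ∑[ i < n ] ∑[ w < p ] (𝟙 (w ≟ v i) * f w) + ∑[ w < p ] (extra w * f w)
      ≡⟨ cong (_+ ∑[ w < p ] (extra w * f w)) (sum-cong-≗ {n} λ i → sum-𝟙≟-* (v i) f) ⟩
    ∑[ i < n ] f (v i) + ∑[ w < p ] (extra w * f w)                 ∎
    where
    open ≡-Reasoning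
    pointwise : ∀ w → f w ≡ ∑[ i < n ] (𝟙 (w ≟ v i) * f w) + extra w * f w
    pointwise w = begin
      f w                                                ≡⟨ *-identityˡ (f w) ⟨
      1 * f w                                            ≡⟨ cong (_* f w) (m+[n∸m]≡n (hits≤1 w)) ⟨
      (hits w + extra w) * f w                           ≡⟨ *-distribʳ-+ (f w) (hits w) _ ⟩
      hits w * f w + extra w * f w                       ≡⟨ cong (_+ extra w * f w) (*-distribʳ-sum {n} (f w) _) ⟩
      ∑[ i < n ] (𝟙 (w ≟ v i) * f w) + extra w * f w     ∎

-- For positive `q`, `k ≤ q * k`, and multiplication by `q` distributes over the minimum. Thus a
-- vertex of degree `q * δ` weighs no more in the inequalities than `q` vertices of degree `δ`.
⊓-*-≤ : ∀ k q δ → k ⊓ (q * δ) ≤ q * (k ⊓ δ)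
⊓-*-≤ k zero    δ = ≤-reflexive (⊓-zeroʳ k)
⊓-*-≤ k (suc q) δ = ≤-trans (⊓-monoˡ-≤ (suc q * δ) (m≤m+n k (q * k))) (≤-reflexive (sym (*-distribˡ-⊓ (suc q) k δ)))

erdősGallai-necessary : ∀ {m p} (d : Fin (suc m) → ℕ) → StrictlyDecreasing d → (∀ i → dLast d ∣ d i) →
                        (G : SimpleGraph p) → HasDegreeSet G d →
                        ∃ λ T → ErdősGallai d T × 2 * numEdges G ≡ sum d + T * dLast d
erdősGallai-necessary {m} {p} d dec δ∣d G (degree∈d , d∈degree) = T , necessary , size
  where
  n = suc m
  δ = dLast d
  v : Fin n → Fin p
  v i = proj₁ (d∈degree i)
  degree-v : ∀ i → degree G (v i) ≡ d i
  degree-v i = proj₂ (d∈degree i)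
  v-injective : ∀ {i j} → v i ≡ v j → i ≡ j
  v-injective {i} {j} vi≡vj = decreasing⇒injective d dec
    (trans (sym (degree-v i)) (trans (cong (degree G) vi≡vj) (degree-v j)))
  x : Fin p → ℕ
  x = extra v v-injective
  δ∣degree : ∀ w → δ ∣ degree G w
  δ∣degree w with i , eq ← degree∈d w = subst (δ ∣_) (sym eq) (δ∣d i)
  q : Fin p → ℕ
  q w = quotient (δ∣degree w)
  degree≡qδ : ∀ w → degree G w ≡ q w * δ
  degree≡qδ w = _∣_.equality (δ∣degree w)
  -- The weight `x w` discards the representatives, so `T` is the number of copies of `δ` that make
  -- up the remaining degrees.
  T : ℕ
  T = ∑[ w < p ] (x w * q w)
  ∑xq : ∀ y → ∑[ w < p ] (x w * (q w * y)) ≡ T * y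
  ∑xq y = trans (sum-cong-≗ {p} λ w → sym (*-assoc (x w) (q w) y)) (sym (*-distribʳ-sum {p} y _))
  size : 2 * numEdges G ≡ sum d + T * δ
  size = begin
    2 * numEdges G                                                    ≡⟨ handshake G ⟩
    ∑[ w < p ] degree G w                                             ≡⟨ ∑-image v v-injective (degree G) ⟩
    ∑[ i < n ] degree G (v i) + ∑[ w < p ] (x w * degree G w)
      ≡⟨ cong₂ _+_ (sum-cong-≗ {n} degree-v) (sum-cong-≗ {p} λ w → cong (x w *_) (degree≡qδ w)) ⟩
    sum d + ∑[ w < p ] (x w * (q w * δ))                              ≡⟨ cong (sum d +_) (∑xq δ) ⟩
    sum d + T * δ                                                     ∎
    where open ≡-Reasoning
  necessary : ErdősGallai d T
  necessary k 1≤k k≤m = begin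
    ∑[ i < n ] (𝟙 (toℕ i <? k) * d i)
      ≡⟨ sum-cong-≗ {n} expand ⟩
    ∑[ i < n ] ∑[ w < p ] (𝟙 (toℕ i <? k) * ⟦ adj G (v i) w ⟧)
      ≡⟨ ∑-comm {n} {p} (λ i w → 𝟙 (toℕ i <? k) * ⟦ adj G (v i) w ⟧) ⟩
    sum a
      ≡⟨ ∑-image v v-injective a ⟩
    ∑[ j < n ] a (v j) + ∑[ w < p ] (x w * a w)
      ≤⟨ +-mono-≤ (sum-mono-≤ {n} a-image) (sum-mono-≤ {p} λ w → *-monoʳ-≤ (x w) (a-extra w)) ⟩
    ∑[ j < n ] (𝟙 (toℕ j <? k) * (k ∸ 1) + 𝟙 (k ≤? toℕ j) * (k ⊓ d j)) + ∑[ w < p ] (x w * (q w * (k ⊓ δ)))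
      ≡⟨ cong₂ _+_ (∑-distrib-+ {n} (λ j → 𝟙 (toℕ j <? k) * (k ∸ 1)) (λ j → 𝟙 (k ≤? toℕ j) * (k ⊓ d j))) (∑xq (k ⊓ δ)) ⟩
    ∑[ j < n ] (𝟙 (toℕ j <? k) * (k ∸ 1)) + ∑[ j < n ] (𝟙 (k ≤? toℕ j) * (k ⊓ d j)) + T * (k ⊓ δ)
      ≡⟨ cong (λ y → y + ∑[ j < n ] (𝟙 (k ≤? toℕ j) * (k ⊓ d j)) + T * (k ⊓ δ)) ∑const ⟩
    k * (k ∸ 1) + ∑[ j < n ] (𝟙 (k ≤? toℕ j) * (k ⊓ d j)) + T * (k ⊓ δ)
      ∎
    where
    open ≤-Reasoning
    -- Neighbours of `w` among the first `k` representatives. Their number is at most `k`, at most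
    -- the degree of `w`, and at most `k ∸ 1` when `w` is itself one of these representatives.
    a : Fin p → ℕ
    a w = ∑[ i < n ] (𝟙 (toℕ i <? k) * ⟦ adj G (v i) w ⟧)
    expand : ∀ i → 𝟙 (toℕ i <? k) * d i ≡ ∑[ w < p ] (𝟙 (toℕ i <? k) * ⟦ adj G (v i) w ⟧)
    expand i = trans (cong (𝟙 (toℕ i <? k) *_) (trans (sym (degree-v i)) (degree≡∑ G (v i))))
      (*-distribˡ-sum {p} (𝟙 (toℕ i <? k)) _)
    ∑below : ∑[ i < n ] 𝟙 (toℕ i <? k) ≡ k
    ∑below = trans (sum-𝟙< n k) (m≤n⇒m⊓n≡m (m≤n⇒m≤1+n k≤m))
    ∑const : ∑[ j < n ] (𝟙 (toℕ j <? k) * (k ∸ 1)) ≡ k * (k ∸ 1)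
    ∑const = trans (sym (*-distribʳ-sum {n} (k ∸ 1) (λ j → 𝟙 (toℕ j <? k)))) (cong (_* (k ∸ 1)) ∑below)
    a≤k : ∀ w → a w ≤ k
    a≤k w = ≤-trans (sum-mono-≤ {n} {g = λ i → 𝟙 (toℕ i <? k)} λ i → *-⟦⟧≤ (𝟙 (toℕ i <? k)) (adj G (v i) w))
      (≤-reflexive ∑below)
    a≤degree : ∀ w → a w ≤ degree G w
    a≤degree w = begin
      a w                                ≤⟨ sum-mono-≤ {n} {g = λ i → ⟦ adj G (v i) w ⟧} (λ i → subst (_≤ ⟦ adj G (v i) w ⟧)
                                              (*-comm ⟦ adj G (v i) w ⟧ _) (*-⟦⟧≤ ⟦ adj G (v i) w ⟧ (does (toℕ i <? k)))) ⟩
      ∑[ i < n ] ⟦ adj G (v i) w ⟧       ≡⟨ sum-cong-≗ {n} (λ i → cong ⟦_⟧ (adj-sym G (v i) w)) ⟩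
      ∑[ i < n ] ⟦ adj G w (v i) ⟧       ≤⟨ m≤m+n _ _ ⟩
      ∑[ i < n ] ⟦ adj G w (v i) ⟧ + ∑[ u < p ] (x u * ⟦ adj G w u ⟧) ≡⟨ ∑-image v v-injective (λ u → ⟦ adj G w u ⟧) ⟨
      ∑[ u < p ] ⟦ adj G w u ⟧           ≡⟨ degree≡∑ G w ⟨
      degree G w                         ∎
    a-extra : ∀ w → a w ≤ q w * (k ⊓ δ)
    a-extra w = ≤-trans (⊓-glb (a≤k w) (subst (a w ≤_) (degree≡qδ w) (a≤degree w))) (⊓-*-≤ k (q w) δ)
    -- Adding the indicator of `j` fills the diagonal entry that irreflexivity leaves empty, and the
    -- total is still at most `k`.
    a-clique : ∀ j → toℕ j < k → a (v j) ≤ k ∸ 1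
    a-clique j j<k = subst (_≤ k ∸ 1) (m+n∸n≡m (a (v j)) 1) (∸-monoˡ-≤ 1 (begin
      a (v j) + 1                          ≡⟨ cong (a (v j) +_) (sum-𝟙≟ j) ⟨
      a (v j) + ∑[ i < n ] 𝟙 (i ≟ j)       ≡⟨ ∑-distrib-+ {n} (λ i → 𝟙 (toℕ i <? k) * ⟦ adj G (v i) (v j) ⟧) (λ i → 𝟙 (i ≟ j)) ⟨
      ∑[ i < n ] (𝟙 (toℕ i <? k) * ⟦ adj G (v i) (v j) ⟧ + 𝟙 (i ≟ j)) ≤⟨ sum-mono-≤ {n} pointwise ⟩
      ∑[ i < n ] 𝟙 (toℕ i <? k)            ≡⟨ ∑below ⟩
      k                                    ∎))
      where
      pointwise : ∀ i → 𝟙 (toℕ i <? k) * ⟦ adj G (v i) (v j) ⟧ + 𝟙 (i ≟ j) ≤ 𝟙 (toℕ i <? k)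
      pointwise i with i ≟ j
      ... | no _ = ≤-trans (≤-reflexive (+-identityʳ _)) (*-⟦⟧≤ (𝟙 (toℕ i <? k)) (adj G (v i) (v j)))
      ... | yes refl rewrite adj-irrefl G (v i) | *-zeroʳ (𝟙 (toℕ i <? k)) = 1≤𝟙 (toℕ i <? k) j<k
    a-image : ∀ j → a (v j) ≤ 𝟙 (toℕ j <? k) * (k ∸ 1) + 𝟙 (k ≤? toℕ j) * (k ⊓ d j)
    a-image j with <-≤-connex (toℕ j) k
    ... | inj₁ j<k rewrite 𝟙-true (toℕ j <? k) j<k =
      m≤n⇒m≤n+o _ (≤-trans (a-clique j j<k) (≤-reflexive (sym (+-identityʳ _))))
    ... | inj₂ k≤j rewrite 𝟙-true (k ≤? toℕ j) k≤j = m≤n⇒m≤o+n (𝟙 (toℕ j <? k) * (k ∸ 1))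
      (≤-trans (⊓-glb (a≤k (v j)) (subst (a (v j) ≤_) (degree-v j) (a≤degree (v j)))) (≤-reflexive (sym (+-identityʳ _))))

open import Data.Integer using (ℤ; +_; -[1+_]; -_; _⊔_; +≤+; -≤+) renaming (_≤_ to _≤ℤ_; _<_ to _<ℤ_; _+_ to _+ℤ_; _*_ to _*ℤ_; _-_ to _-ℤ_; suc to sucℤ)
open import Data.Integer.DivMod using (_/ℕ_; [n/ℕd]*d≤n; n<s[n/ℕd]*d)
import Data.Integer.Properties as ℤ
open import Data.Integer.Tactic.RingSolver using (solve-∀)
open import Data.Nat.Tactic.RingSolver using () renaming (solve-∀ to ℕ-solve-∀)

-- The constants c and C⋆

-- With `- a` as argument, the ceiling is minus the floor of `a / s`, up to a double negation. So
-- `- C` is at most this floor, and the floor times `s` is at most `a`.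
ceilDiv≤⇒ : ∀ a s .{{_ : NonZero s}} C → ceilDiv (- a) s ≤ℤ + C → - (+ (C * s)) ≤ℤ a
ceilDiv≤⇒ a s@(suc _) C ⌈⌉≤C = begin
  - (+ (C * s))                ≡⟨ cong -_ (ℤ.pos-* C s) ⟩
  - (+ C *ℤ + s)               ≡⟨ ℤ.neg-distribˡ-* (+ C) (+ s) ⟩
  - (+ C) *ℤ + s               ≤⟨ ℤ.*-monoʳ-≤-nonNeg (+ s) (subst (- (+ C) ≤ℤ_) (ℤ.neg-involutive _) (ℤ.neg-mono-≤ ⌈⌉≤C)) ⟩
  ((- (- a)) /ℕ s) *ℤ + s      ≤⟨ [n/ℕd]*d≤n (- (- a)) s ⟩
  - (- a)                      ≡⟨ ℤ.neg-involutive a ⟩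
  a                            ∎
  where open ℤ.≤-Reasoning

-- With `q` the floor, `- C * s ≤ a < (q + 1) * s` gives `- C < q + 1`, hence `- C ≤ q` for
-- integers.
⇒ceilDiv≤ : ∀ a s .{{_ : NonZero s}} C → - (+ (C * s)) ≤ℤ a → ceilDiv (- a) s ≤ℤ + C
⇒ceilDiv≤ a s@(suc _) C -Cs≤a = subst (ceilDiv (- a) s ≤ℤ_) (ℤ.neg-involutive (+ C)) (ℤ.neg-mono-≤ -C≤q)
  where
  q = (- (- a)) /ℕ s
  -Cs<[1+q]s : - (+ C) *ℤ + s <ℤ sucℤ q *ℤ + s
  -Cs<[1+q]s = begin-strict
    - (+ C) *ℤ + s     ≡⟨ ℤ.neg-distribˡ-* (+ C) (+ s) ⟨
    - (+ C *ℤ + s)     ≡⟨ cong -_ (ℤ.pos-* C s) ⟨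
    - (+ (C * s))      ≤⟨ -Cs≤a ⟩
    a                  ≡⟨ ℤ.neg-involutive a ⟨
    - (- a)            <⟨ n<s[n/ℕd]*d (- (- a)) s ⟩
    sucℤ q *ℤ + s      ∎
    where open ℤ.≤-Reasoning
  -C≤q : - (+ C) ≤ℤ q
  -C≤q = subst₂ _≤ℤ_ (ℤ.pred-suc (- (+ C))) (ℤ.pred-suc q)
    (ℤ.pred-mono (ℤ.i<j⇒suc[i]≤j (ℤ.*-cancelʳ-<-nonNeg {i = - (+ C)} {j = sucℤ q} (+ s) -Cs<[1+q]s)))

-≤-⇒≤+ : ∀ p b y → - (+ y) ≤ℤ + p -ℤ + b → b ≤ p + y
-≤-⇒≤+ p b y le = ℤ.drop‿+≤+ (subst₂ _≤ℤ_ (left (+ b) (+ y)) (right (+ p) (+ b) (+ y)) (ℤ.+-monoˡ-≤ (+ b +ℤ + y) le))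
  where
  left : ∀ b y → - y +ℤ (b +ℤ y) ≡ b
  left = solve-∀
  right : ∀ p b y → (p -ℤ b) +ℤ (b +ℤ y) ≡ p +ℤ y
  right = solve-∀

≤+⇒-≤- : ∀ p b y → b ≤ p + y → - (+ y) ≤ℤ + p -ℤ + b
≤+⇒-≤- p b y le = subst₂ _≤ℤ_ (left (+ b) (+ y)) (right (+ p) (+ b) (+ y)) (ℤ.+-monoˡ-≤ (- (+ b) -ℤ + y) (+≤+ le))
  where
  left : ∀ b y → b +ℤ (- b -ℤ y) ≡ - y
  left = solve-∀
  right : ∀ p b y → (p +ℤ y) +ℤ (- b -ℤ y) ≡ p -ℤ b
  right = solve-∀

-- `upTo` is `applyUpTo` of the identity; `g` is arbitrary because the induction shifts it to
-- `g ∘ suc`.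
foldr-⊔≤ : ∀ (f : ℕ → ℤ) (g : ℕ → ℕ) e m x → e ≤ℤ x → (∀ i → i < m → f (g i) ≤ℤ x) →
           foldr _⊔_ e (map f (applyUpTo g m)) ≤ℤ x
foldr-⊔≤ f g e zero    x e≤x f≤x = e≤x
foldr-⊔≤ f g e (suc m) x e≤x f≤x =
  ℤ.⊔-lub (f≤x 0 z<s) (foldr-⊔≤ f (g ∘ suc) e m x e≤x λ i i<m → f≤x (suc i) (s≤s i<m))

≤foldr-⊔ : ∀ (f : ℕ → ℤ) (g : ℕ → ℕ) e m i → i < m → f (g i) ≤ℤ foldr _⊔_ e (map f (applyUpTo g m))
≤foldr-⊔ f g e (suc m) zero    _         = ℤ.i≤i⊔j _ _
≤foldr-⊔ f g e (suc m) (suc i) (s≤s i<m) = ℤ.i≤j⇒i≤k⊔j (f (g 0)) (≤foldr-⊔ f (g ∘ suc) e m i i<m)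

sum-take-tabulate : ∀ {n} (d : Fin n → ℕ) k → List.sum (take k (tabulate d)) ≡ ∑[ i < n ] (𝟙 (toℕ i <? k) * d i)
sum-take-tabulate {n}     d zero    = sym (trans (sum-const n 0) (*-zeroʳ n))
sum-take-tabulate {zero}  d (suc k) = refl
sum-take-tabulate {suc n} d (suc k) = cong₂ _+_ (sym (*-identityˡ (d zero))) (sum-take-tabulate (d ∘ suc) k)

sum-drop-tabulate : ∀ {n} (d : Fin n → ℕ) (f : ℕ → ℕ) k →
                    List.sum (map f (drop k (tabulate d))) ≡ ∑[ i < n ] (𝟙 (k ≤? toℕ i) * f (d i))
sum-drop-tabulate {n} d f zero = trans (cong List.sum (map-tabulate d f))
  (trans (List-sum-tabulate (f ∘ d)) (sum-cong-≗ {n} λ i → sym (*-identityˡ _)))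
sum-drop-tabulate {zero}  d f (suc k) = refl
sum-drop-tabulate {suc n} d f (suc k) = trans (sum-drop-tabulate (d ∘ suc) f k)
  (sum-cong-≗ {n} λ i → cong (λ b → ⟦ b ⟧ * f (d (suc i))) (≤?-suc k (toℕ i)))
  where
  ≤?-suc : ∀ k l → does (k ≤? l) ≡ does (suc k ≤? suc l)
  ≤?-suc zero    l = refl
  ≤?-suc (suc k) l = refl

module _ {m} (1≤m : 1 ≤ m) (d : Fin (suc m) → ℕ) (pos : ∀ i → d i > 0) where

  private
    δ = dLast d

    term : ℕ → ℤ
    term k = ceilDiv (- Δ (seq d) k) (k ⊓ δ)

    A B : ℕ → ℕ
    A k = ∑[ i < suc m ] (𝟙 (k ≤? toℕ i) * (k ⊓ d i))
    B k = ∑[ i < suc m ] (𝟙 (toℕ i <? k) * d i)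

    Δ≡ : ∀ k → Δ (seq d) k ≡ + (k * (k ∸ 1) + A k) -ℤ + B k
    Δ≡ k = cong₂ (λ a b → + (k * (k ∸ 1) + a) -ℤ + b) (sum-drop-tabulate d (k ⊓_) k) (sum-take-tabulate d k)

    k⊓δ≢0 : ∀ {k} → 1 ≤ k → NonZero (k ⊓ δ)
    k⊓δ≢0 1≤k = >-nonZero (⊓-glb 1≤k (pos (fromℕ m)))

  -- Each inequality is one ceiling bound with its denominator `k ⊓ δ` cleared, which is positive by
  -- `pos`. With the converse below, the condition `c ≤ C` can be exchanged for the whole family of
  -- inequalities.
  cConst≤⇒ErdősGallai : ∀ C → cConst d ≤ℤ + C → ErdősGallai d C
  cConst≤⇒ErdősGallai C c≤C (suc k) 1≤k k≤m = -≤-⇒≤+ _ _ _ (subst (- (+ (C * (suc k ⊓ δ))) ≤ℤ_) (Δ≡ (suc k))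
    (ceilDiv≤⇒ (Δ (seq d) (suc k)) (suc k ⊓ δ) {{k⊓δ≢0 1≤k}} C
      (ℤ.≤-trans (≤foldr-⊔ (λ j → term (suc j)) (λ j → j) (term 1) m k k≤m) c≤C)))

  ErdősGallai⇒cConst≤ : ∀ C → ErdősGallai d C → cConst d ≤ℤ + C
  ErdősGallai⇒cConst≤ C EG = foldr-⊔≤ (λ j → term (suc j)) (λ j → j) (term 1) m (+ C)
    -- The fold starts from `term 1`, an admissible term because `1 ≤ m`.
    (term≤ 1 ≤-refl 1≤m) λ k k<m → term≤ (suc k) z<s k<m
    where
    term≤ : ∀ k → 1 ≤ k → k ≤ m → term k ≤ℤ + C
    term≤ k 1≤k k≤m = ⇒ceilDiv≤ (Δ (seq d) k) (k ⊓ δ) {{k⊓δ≢0 1≤k}} C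
      (subst (- (+ (C * (k ⊓ δ))) ≤ℤ_) (sym (Δ≡ k)) (≤+⇒-≤- _ _ _ (EG k 1≤k k≤m)))

-- Parity and the choice of C⋆

evenℕ-true⇒ : ∀ n → evenℕ n ≡ true → 2 ∣ n
evenℕ-true⇒ n eq = m%n≡0⇒n∣m n 2 (does-true⇒ (n % 2 ℕ.≟ 0) eq)

evenℕ-false⇒ : ∀ n → evenℕ n ≡ false → n % 2 ≡ 1
evenℕ-false⇒ n eq with n % 2 | m%n<n n 2
evenℕ-false⇒ n ()  | 0 | _
... | 1 | _ = refl
... | suc (suc _) | s≤s (s≤s ())

odd+odd : ∀ a b → a % 2 ≡ 1 → b % 2 ≡ 1 → 2 ∣ a + b
odd+odd a b a-odd b-odd = m%n≡0⇒n∣m (a + b) 2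
  (trans (%-distribˡ-+ a b 2) (cong₂ (λ x y → (x + y) % 2) a-odd b-odd))

∣-sum : ∀ {n} k (f : Fin n → ℕ) → (∀ i → k ∣ f i) → k ∣ sum f
∣-sum {zero}  k f k∣f = k ∣0
∣-sum {suc n} k f k∣f = ∣m∣n⇒∣m+n (k∣f zero) (∣-sum k (f ∘ suc) (k∣f ∘ suc))

-- If `dLast d` is even, all values of `d` are even and every `T` passes the parity test. If it is
-- odd, the parity of `sum d + T * dLast d` alternates with `T`, so the first `T` from `c` on that
-- passes is `c` or `c + 1`.
Cstar-least : ∀ {m} (d : Fin (suc m) → ℕ) → (∀ i → dLast d ∣ d i) → ∀ c → cConst d ≡ + c →
              ∃ λ C → Cstar d ≡ + C × c ≤ C × 2 ∣ sum d + C * dLast d ×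
                      (∀ T → c ≤ T → 2 ∣ sum d + T * dLast d → C ≤ T)
Cstar-least d δ∣d c c≡ with evenℕ (dLast d) in δ-parity
... | true = c , c≡ , ≤-refl , ∣m∣n⇒∣m+n (∣-sum 2 d λ i → ∣-trans 2∣δ (δ∣d i)) (∣n⇒∣m*n c 2∣δ) , λ T c≤T _ → c≤T
  where 2∣δ = evenℕ-true⇒ (dLast d) δ-parity
... | false rewrite c≡ | sym (ℤ.pos-* c (dLast d)) | List-sum-tabulate d
  with evenℕ (sum d + c * dLast d) in parity
... | true  = c , refl , ≤-refl , evenℕ-true⇒ _ parity , λ T c≤T _ → c≤T
... | false = c + 1 , refl , m≤m+n c 1 , even , least
  where
  odd = evenℕ-false⇒ (sum d + c * dLast d) parity
  even : 2 ∣ sum d + (c + 1) * dLast d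
  even = subst (2 ∣_) (rearrange (sum d) c (dLast d)) (odd+odd (sum d + c * dLast d) (dLast d) odd (evenℕ-false⇒ (dLast d) δ-parity))
    where
    rearrange : ∀ s c δ → s + c * δ + δ ≡ s + (c + 1) * δ
    rearrange = ℕ-solve-∀
  least : ∀ T → c ≤ T → 2 ∣ sum d + T * dLast d → c + 1 ≤ T
  least T c≤T 2∣ with m≤n⇒m<n∨m≡n c≤T
  ... | inj₁ c<T  = subst (_≤ T) (+-comm 1 c) c<T
  ... | inj₂ refl = contradiction (trans (sym odd) (n∣m⇒m%n≡0 (sum d + c * dLast d) 2 2∣)) λ ()

-- The quotients of `d i` by `δ` strictly decrease and end at a positive number, so the first is at
-- least `m + 1`. Hence `δ + m ≤ (m + 1) * δ ≤ d zero ≤ C + m`. The result supplies `room` and the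
-- nonnegativity of `c`.
ErdősGallai⇒δ≤C : ∀ {m} → 1 ≤ m → (d : Fin (suc m) → ℕ) → (∀ i → d i > 0) → StrictlyDecreasing d → (∀ i → dLast d ∣ d i) →
                  ∀ C → ErdősGallai d C → dLast d ≤ C
ErdősGallai⇒δ≤C {m} 1≤m d pos dec δ∣d C EG = +-cancelʳ-≤ m _ _ (begin
  δ + m                  ≤⟨ +-monoʳ-≤ δ (m≤m*n m δ) ⟩
  suc m * δ              ≤⟨ *-monoˡ-≤ δ suc-m≤e₀ ⟩
  e zero * δ             ≡⟨ d≡eδ zero ⟨
  d zero                 ≤⟨ ErdősGallai⇒d₀≤C+m 1≤m d C EG ⟩
  C + m                  ∎)
  where
  open ≤-Reasoning
  δ = dLast d
  instance
    δ≢0 : NonZero δ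
    δ≢0 = >-nonZero (pos (fromℕ m))
  e : Fin (suc m) → ℕ
  e i = quotient (δ∣d i)
  d≡eδ : ∀ i → d i ≡ e i * δ
  d≡eδ i = _∣_.equality (δ∣d i)
  e-decreasing : StrictlyDecreasing e
  e-decreasing i j i<j = *-cancelʳ-< δ (e j) (e i) (subst₂ _<_ (d≡eδ j) (d≡eδ i) (dec i j i<j))
  1≤eₘ : 1 ≤ e (fromℕ m)
  1≤eₘ = *-cancelʳ-< δ 0 (e (fromℕ m)) (subst (0 <_) (d≡eδ (fromℕ m)) (pos (fromℕ m)))
  suc-m≤e₀ : suc m ≤ e zero
  suc-m≤e₀ = begin
    suc m                            ≤⟨ +-monoˡ-≤ m 1≤eₘ ⟩
    e (fromℕ m) + m                  ≡⟨ cong (λ x → e (fromℕ m) + x) (toℕ-fromℕ m) ⟨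
    e (fromℕ m) + toℕ (fromℕ m)      ≤⟨ decreasing-slope e e-decreasing zero (fromℕ m) z≤n ⟩
    e zero + 0                       ≡⟨ +-identityʳ _ ⟩
    e zero                           ∎

-- A negative `c` would make the inequalities hold with `C = 0`, and `ErdősGallai⇒δ≤C` would then
-- give `δ ≤ 0`.
cConst-natural : ∀ {m} → 1 ≤ m → (d : Fin (suc m) → ℕ) → (∀ i → d i > 0) → StrictlyDecreasing d →
                 (∀ i → dLast d ∣ d i) → ∃ λ c → cConst d ≡ + c
cConst-natural 1≤m d pos dec δ∣d with cConst d in c≡
... | + c      = c , refl
... | -[1+ c ] = contradiction (ErdősGallai⇒δ≤C 1≤m d pos dec δ∣d 0 (cConst≤⇒ErdősGallai 1≤m d pos 0 (subst (_≤ℤ + 0) (sym c≡) -≤+)))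
                               (<⇒≱ (pos _))

-- Attainment and minimality of the edge count

theorem4 : (m : ℕ) → 1 ≤ m → (d : Fin (suc m) → ℕ)
    → (∀ i → d i > 0)
    → (∀ (i j : Fin (suc m)) → toℕ i < toℕ j → d i > d j)
    → (∀ i → d (fromℕ m) ∣ d i)
    → (Σ ℕ (λ v → Σ (SimpleGraph v) (λ G → HasDegreeSet G d × (+ (2 * numEdges G) ≡ + σ d +ℤ Cstar d *ℤ + dLast d))))
    × (∀ (v : ℕ) (G : SimpleGraph v) → HasDegreeSet G d → + σ d +ℤ Cstar d *ℤ + dLast d ≤ℤ + (2 * numEdges G))
theorem4 m 1≤m d pos dec δ∣d with c , c≡ ← cConst-natural 1≤m d pos dec δ∣d =
  conclude (Cstar-least d δ∣d c c≡)
  where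
  δ = dLast d
  conclude : (∃ λ C → Cstar d ≡ + C × c ≤ C × 2 ∣ sum d + C * δ × (∀ T → c ≤ T → 2 ∣ sum d + T * δ → C ≤ T)) →
             (Σ ℕ (λ v → Σ (SimpleGraph v) (λ G → HasDegreeSet G d × (+ (2 * numEdges G) ≡ + σ d +ℤ Cstar d *ℤ + δ))))
             × (∀ (v : ℕ) (G : SimpleGraph v) → HasDegreeSet G d → + σ d +ℤ Cstar d *ℤ + δ ≤ℤ + (2 * numEdges G))
  conclude (C , C≡ , c≤C , even , least) =
    attained (Realization.realization 1≤m d pos dec C EG (ErdősGallai⇒δ≤C 1≤m d pos dec δ∣d C EG) even) ,
    λ v G degrees → minimal G (erdősGallai-necessary d dec δ∣d G degrees)
    where
    total : + σ d +ℤ Cstar d *ℤ + δ ≡ + (sum d + C * δ)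
    total = trans (cong₂ (λ s C → + s +ℤ C *ℤ + δ) (List-sum-tabulate d) C≡) (cong (λ x → + sum d +ℤ x) (sym (ℤ.pos-* C δ)))
    EG : ErdősGallai d C
    EG = cConst≤⇒ErdősGallai 1≤m d pos C (subst (_≤ℤ + C) (sym c≡) (+≤+ c≤C))
    attained : (∃₂ λ v (G : SimpleGraph v) → HasDegreeSet G d × 2 * numEdges G ≡ sum d + C * δ) →
               Σ ℕ (λ v → Σ (SimpleGraph v) (λ G → HasDegreeSet G d × (+ (2 * numEdges G) ≡ + σ d +ℤ Cstar d *ℤ + δ)))
    attained (v , G , degrees , size) = v , G , degrees , trans (cong +_ size) (sym total)
    minimal : ∀ {v} (G : SimpleGraph v) → (∃ λ T → ErdősGallai d T × 2 * numEdges G ≡ sum d + T * δ) →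
              + σ d +ℤ Cstar d *ℤ + δ ≤ℤ + (2 * numEdges G)
    minimal G (T , EG-T , size) =
      -- The edge count itself witnesses that `sum d + T * δ` is even, so `least` applies to `T`.
      subst (_≤ℤ + (2 * numEdges G)) (sym total) (+≤+ (subst (sum d + C * δ ≤_) (sym size)
        (+-monoʳ-≤ (sum d) (*-monoˡ-≤ δ (least T c≤T (divides (numEdges G) (trans (sym size) (*-comm 2 (numEdges G)))))))))
      where
      c≤T : c ≤ T
      c≤T = ℤ.drop‿+≤+ (subst (_≤ℤ + T) c≡ (ErdősGallai⇒cConst≤ 1≤m d pos T EG-T))
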